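{- Let $D\subseteq \mathrm{CP}$ be an abstract constraint domain endowed with a least upper bound operator $\sqcup$, a widening operator $\nabla$, an abstraction operator $\alpha$ and a projection operator $\Downarrow$, and let a Partition operator be fixed. Let the set $P\cup\{C\}$ of constrained Horn clauses, where $C$ is a clause whose head predicate does not occur in $P$, be the input of the APP strategy (Predicate Pairing with Abstraction, the procedure defined in the context). If the strategy terminates and returns a set $\mathit{TransfCls}$ of clauses, then $P\cup\{C\}$ is satisfiable if and only if $\mathit{TransfCls}$ is satisfiable.
   Context: **Constraints.** CP (Convex Closed Polyhedra) is the constraint domain whose atomic constraints are of the form $a_1\cdot x_1+\dots+a_n\cdot x_n\le a$, where $a,a_1,\dots,a_n$ are real coefficients and $x_1,\dots,x_n$ are variables. A constraint is either $\mathit{true}$, or $\mathit{false}$, or an atomic constraint, or a conjunction of constraints. Convex polyhedra are identified with linear arithmetic formulas. $\forall(F)$ and $\exists(F)$ denote universal and existential closure; $\mathit{vars}(F)$ is the set of variables occurring in $F$. A constraint $c$ is satisfiable if $\mathrm{CP}\models\exists(c)$. We write $c\sqsubseteq d$ ($c$ entails $d$) if $\mathrm{CP}\models\forall(c\rightarrow d)$; $c$ and $d$ are equivalent if $c\sqsubseteq d$ and $d\sqsubseteq c$. **Abstract constraint domain.** $D\subseteq\mathrm{CP}$ is a set of constraints ($D$-constraints) containing $\mathit{true}$ and $\mathit{false}$ and closed under conjunction (e.g. CP itself, Octagons, Bounded Differences, Boxes), with the following operators. - Least upper bound $\sqcup:D\times D\to D$: $c\sqsubseteq c\sqcup d$,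 $d\sqsubseteq c\sqcup d$, and for all $D$-constraints $e$, if $c\sqsubseteq e$ and $d\sqsubseteq e$ then $c\sqcup d\sqsubseteq e$. - Widening $\nabla:D\times D\to D$: $c\sqsubseteq c\nabla d$, $d\sqsubseteq c\nabla d$, and for all chains $y_0\sqsubseteq y_1\sqsubseteq\cdots$, the chain $x_0\sqsubseteq x_1\sqsubseteq\cdots$, where $x_0=y_0$ and, for $i>0$, $x_{i+1}=x_i\nabla y_{i+1}$, is finite. - Abstraction $\alpha:\mathrm{CP}\to D$: $c\sqsubseteq\alpha(c)$, and for all $D$-constraints $e$, if $c\sqsubseteq e$ then $\alpha(c)\sqsubseteq e$. - Projection of a $D$-constraint $c$ onto a set $X$ of variables, $c\Downarrow X$: a $D$-constraint with variables in $X$ that is equivalent to $\exists Y.\,c$, where $Y=\mathit{vars}(c)\setminus X$. **Clauses.** An atom is a formula $p(X_1,\dots,X_m)$, where $p$ is a predicate symbol different from $\le$ and $X_1,\dots,X_m$ are distinct variables. A constrained Horn clause (clause) is an implication $A\leftarrow c,G$ (comma denotes conjunction), where the head $A$ is either an atom or $\mathit{false}$, and the body is the conjunction of a constraint $c$ and a (possibly empty) conjunction $G$ of atoms; the empty conjunction is identified with $\mathit{true}$. It is assumed, without loss of generality, that distinct atoms in the body of a clause have disjoint sets of variables, so that relations among variables (including equalities) are explicitly written as constraints in the body. A set $S$ of clauses is satisfiable if $S\cup\mathrm{CP}$ has a model, or equivalently, $S\cup\mathrm{CP}\not\models\mathit{false}$. **Unfolding rule.** Let $P$ be a set of clauses and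 $C$ a clause of the form $H\leftarrow c,L,A,R$, where $A$ is an atom and $L,R$ are (possibly empty) conjunctions of atoms. Let $\{A\leftarrow c_i,B_i\mid i=1,\dots,m\}$ be the set of all clauses in $P$ whose head is $A$ (after renaming). Unfolding $C$ w.r.t. $A$ using $P$ derives the set of clauses $\{H\leftarrow c,c_i,L,B_i,R\mid i=1,\dots,m\}$. **Partition operator.** Given a clause, it determines which atoms are to be tupled together, by splitting any conjunction $G$ of atoms in the body of the clause into $n$ $(\ge 1)$ subconjunctions $G_1,\dots,G_n$. **APP strategy.** Input: a set $P\cup\{C\}$ of clauses, where $C$ is a clause whose head predicate does not occur in $P$. Output: a set $\mathit{TransfCls}$ of clauses. The strategy constructs a tree $\mathit{Defs}$ of definitions, that is, clauses whose head predicates do not occur in $P$. A definition is a child of a definition $C$ (its parent) if it is introduced to fold a clause derived by unfolding from $C$; the ancestor relation on $\mathit{Defs}$ is the reflexive, transitive closure of the parent relation. Initialization: $\mathit{InCls}:=\{C\}$; $\mathit{Defs}$ is the tree made out of the root clause $C$ only; $\mathit{TransfCls}:=P$. While there is a clause $C$ in $\mathit{InCls}$ (here $C$ denotes the current clause), of the form $H\leftarrow c,B$, do: 1. (Unfolding) From $C$ derive a set $U(C)$ of clauses by unfolding $C$ with respect to each atom occurring in its body using $P$. 2. (Clause deletion) Remove from $U(C)$ all clauses with an unsatisfiable constraint. 3. (Definition & Folding) For every clause $E\in U(C)$, of the form $H\leftarrow d,G$, do: - partition (by the Partition operator) the conjunction $G$ into $n\,(\ge 1)$ subconjunctions $G_1,\dots,G_n$;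 - for $i=1,\dots,n$: let $d_i:=\alpha(d)\Downarrow V_i$, where $V_i$ is the set of variables in $G_i$. If in $\mathit{Defs}$ there is a clause $\mathit{newp}_i(V_i)\leftarrow e_i,G_i$ such that $d_i\sqsubseteq e_i$, no new definition is introduced and that clause's head predicate is the $\mathit{newp}_i$ used below. If there is no such clause, then a definition $D_i$ with a new head predicate $\mathit{newp}_i$ is introduced: if in $\mathit{Defs}$ there is an ancestor clause of $C$ of the form $\mathit{newq}(V_i)\leftarrow f_i,G_i$, then $D_i:=(\mathit{newp}_i(V_i)\leftarrow a_i,G_i)$, where $a_i=f_i\nabla(f_i\sqcup d_i)$; else $D_i:=(\mathit{newp}_i(V_i)\leftarrow d_i,G_i)$; then $\mathit{InCls}:=\mathit{InCls}\cup\{D_i\}$ and $D_i$ is added as a child of $C$ in $\mathit{Defs}$; - $\mathit{TransfCls}:=\mathit{TransfCls}\cup\{H\leftarrow d,\mathit{newp}_1(V_1),\dots,\mathit{newp}_n(V_n)\}$; - $U(C):=U(C)\setminus\{E\}$. 4. $\mathit{InCls}:=\mathit{InCls}\setminus\{C\}$.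
   Formalization: The Partition operator splits bodies into nonempty subconjunctions, so a clause with empty body (n = 0 instead of n ≥ 1) is kept unfolded; folding an empty conjunction could give newp ← newp and make the claim false. -}

module Defs where

open import Data.Empty using (⊥)
open import Data.List.Base as List using (List; []; _∷_; [_]; _++_; concat; concatMap; filter; foldr; map)
open import Data.List.Membership.Propositional using (_∈_; _∉_)
open import Data.List.NonEmpty.Base as List⁺ using (List⁺)
open import Data.List.Relation.Binary.Disjoint.Propositional using (Disjoint)
open import Data.List.Relation.Binary.Permutation.Propositional using (_↭_)
open import Data.List.Relation.Binary.Pointwise.Base using (Pointwise)
open import Data.List.Relation.Binary.Subset.Propositional using (_⊆_)
open import Data.List.Relation.Ternary.Interleaving.Propositional using (Interleaving)
open import Data.List.Relation.Unary.All using (All)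
open import Data.List.Relation.Unary.AllPairs using (AllPairs)
open import Data.List.Relation.Unary.Any using (_─_)
open import Data.List.Relation.Unary.Unique.Propositional using (Unique)
open import Data.Maybe.Base as Maybe using (Maybe; just; nothing; maybe′)
import Data.Maybe.Properties as Maybe
open import Data.Nat.Base as ℕ using (ℕ; suc)
import Data.Nat.Properties as ℕ
open import Data.Product.Base using (Σ; ∃; ∃-syntax; Σ-syntax; _×_; _,_; proj₁; proj₂; map₂)
import Data.Product.Properties as Product
open import Data.Rational.Base as ℚ using (ℚ; 0ℚ; 1ℚ; ½; 1/_; ∣_∣)
import Data.Rational.Properties as ℚ
open import Data.Rational.Solver using (module +-*-Solver)
open import Data.Refinement.Base using (Refinement; Refinement-syntax; value)
open import Data.Unit.Base using (⊤)
open import Data.Vec.Base as Vec using (Vec)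
import Data.Vec.Relation.Binary.Pointwise.Inductive as VecPointwise
open import Function.Base using (_∘_)
open import Function.Bundles using (_⇔_; _↔_; Inverse)
open import Level using (Level; 0ℓ) renaming (suc to lsuc)
open import Relation.Binary.Construct.Closure.ReflexiveTransitive using (Star)
open import Relation.Binary.Definitions using (DecidableEquality)
open import Relation.Binary.PropositionalEquality using (_≡_; refl; sym; trans; cong; cong₂; subst)
open import Relation.Nullary.Decidable using (¬?)
open import Relation.Nullary.Negation using (¬_)
open import Relation.Unary using (Pred)

open import Data.List.Membership.DecPropositional ℕ._≟_ using (_∈?_)

-- Reals are Cauchy sequences of rationals, considered up to _≃_.
IsCauchy : (ℕ → ℚ) → Set
IsCauchy s = ∀ ε → 0ℚ ℚ.< ε →
  ∃[ N ] (∀ m n → N ℕ.≤ m → N ℕ.≤ n → ∣ s m ℚ.- s n ∣ ℚ.≤ ε)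

record ℝ : Set where
  constructor _,_
  field
    seq    : ℕ → ℚ
    cauchy : IsCauchy seq

open ℝ public

infix 4 _≤ʳ_ _≃_

_≤ʳ_ : ℝ → ℝ → Set
x ≤ʳ y = ∀ ε → 0ℚ ℚ.< ε → ∃[ N ] (∀ n → N ℕ.≤ n → seq x n ℚ.≤ seq y n ℚ.+ ε)

_≃_ : ℝ → ℝ → Set
x ≃ y = x ≤ʳ y × y ≤ʳ x

private
  module S = +-*-Solver
  open ℚ.≤-Reasoning

  half-pos : ∀ ε → 0ℚ ℚ.< ε → 0ℚ ℚ.< ½ ℚ.* ε
  half-pos ε ε>0 = ℚ.positive⁻¹ _ ⦃ ℚ.pos*pos⇒pos ½ ε ⦃ ℚ.positive ε>0 ⦄ ⦄

  half+half : ∀ ε → ½ ℚ.* ε ℚ.+ ½ ℚ.* ε ≡ ε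
  half+half ε = trans (sym (ℚ.*-distribʳ-+ ε ½ ½)) (ℚ.*-identityˡ ε)

  swap-sum : ∀ a b c d → (a ℚ.+ b) ℚ.- (c ℚ.+ d) ≡ (a ℚ.- c) ℚ.+ (b ℚ.- d)
  swap-sum = S.solve 4 (λ a b c d → (a S.:+ b) S.:- (c S.:+ d) S.:= (a S.:- c) S.:+ (b S.:- d)) refl

  split-product : ∀ a b c d → a ℚ.* b ℚ.- c ℚ.* d ≡ a ℚ.* (b ℚ.- d) ℚ.+ d ℚ.* (a ℚ.- c)
  split-product = S.solve 4 (λ a b c d →
    a S.:* b S.:- c S.:* d S.:= a S.:* (b S.:- d) S.:+ d S.:* (a S.:- c)) refl

  add-sub : ∀ a b → a ≡ (a ℚ.- b) ℚ.+ b
  add-sub = S.solve 2 (λ a b → a S.:= (a S.:- b) S.:+ b) refl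

fromℚ : ℚ → ℝ
fromℚ q = (λ _ → q) , λ ε ε>0 → 0 , λ _ _ _ _ →
  ℚ.≤-trans (ℚ.≤-reflexive (cong ∣_∣ (ℚ.+-inverseʳ q))) (ℚ.<⇒≤ ε>0)

0ʳ : ℝ
0ʳ = fromℚ 0ℚ

eventuallyBounded : (x : ℝ) →
  ∃[ K ] 0ℚ ℚ.< K × ∃[ N ] (∀ n → N ℕ.≤ n → ∣ seq x n ∣ ℚ.≤ K)
eventuallyBounded x with cauchy x 1ℚ (ℚ.positive⁻¹ 1ℚ)
... | N , close = 1ℚ ℚ.+ ∣ seq x N ∣
  , ℚ.+-mono-<-≤ (ℚ.positive⁻¹ 1ℚ) (ℚ.0≤∣p∣ (seq x N))
  , N , λ n N≤n → begin
    ∣ seq x n ∣                                   ≡⟨ cong ∣_∣ (add-sub (seq x n) (seq x N)) ⟩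
    ∣ (seq x n ℚ.- seq x N) ℚ.+ seq x N ∣         ≤⟨ ℚ.∣p+q∣≤∣p∣+∣q∣ (seq x n ℚ.- seq x N) (seq x N) ⟩
    ∣ seq x n ℚ.- seq x N ∣ ℚ.+ ∣ seq x N ∣       ≤⟨ ℚ.+-monoˡ-≤ ∣ seq x N ∣ (close n N N≤n ℕ.≤-refl) ⟩
    1ℚ ℚ.+ ∣ seq x N ∣                            ∎

infixl 6 _+ʳ_
infixl 7 _*ʳ_

_+ʳ_ : ℝ → ℝ → ℝ
x +ʳ y = (λ n → seq x n ℚ.+ seq y n) , λ ε ε>0 →
  let N₁ , close₁ = cauchy x (½ ℚ.* ε) (half-pos ε ε>0)
      N₂ , close₂ = cauchy y (½ ℚ.* ε) (half-pos ε ε>0)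
  in N₁ ℕ.⊔ N₂ , λ m n N≤m N≤n → begin
    ∣ (seq x m ℚ.+ seq y m) ℚ.- (seq x n ℚ.+ seq y n) ∣
      ≡⟨ cong ∣_∣ (swap-sum (seq x m) (seq y m) (seq x n) (seq y n)) ⟩
    ∣ (seq x m ℚ.- seq x n) ℚ.+ (seq y m ℚ.- seq y n) ∣
      ≤⟨ ℚ.∣p+q∣≤∣p∣+∣q∣ (seq x m ℚ.- seq x n) (seq y m ℚ.- seq y n) ⟩
    ∣ seq x m ℚ.- seq x n ∣ ℚ.+ ∣ seq y m ℚ.- seq y n ∣
      ≤⟨ ℚ.+-mono-≤ (close₁ m n (ℕ.m⊔n≤o⇒m≤o N₁ N₂ N≤m) (ℕ.m⊔n≤o⇒m≤o N₁ N₂ N≤n))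
                    (close₂ m n (ℕ.m⊔n≤o⇒n≤o N₁ N₂ N≤m) (ℕ.m⊔n≤o⇒n≤o N₁ N₂ N≤n)) ⟩
    ½ ℚ.* ε ℚ.+ ½ ℚ.* ε
      ≡⟨ half+half ε ⟩
    ε ∎

private
  l : ∀ i j {n} → i ℕ.⊔ j ℕ.≤ n → i ℕ.≤ n
  l i j = ℕ.m⊔n≤o⇒m≤o i j

  r : ∀ i j {n} → i ℕ.⊔ j ℕ.≤ n → j ℕ.≤ n
  r i j = ℕ.m⊔n≤o⇒n≤o i j

  shrink : ∀ K ε → 0ℚ ℚ.< K → 0ℚ ℚ.< ε → ∃[ δ ] 0ℚ ℚ.< δ × K ℚ.* δ ≡ ε
  shrink K ε K>0 ε>0 = 1/K ℚ.* ε
    , ℚ.positive⁻¹ _ ⦃ ℚ.pos*pos⇒pos 1/K ⦃ ℚ.1/pos⇒pos K ⦄ ε ⦃ ℚ.positive ε>0 ⦄ ⦄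
    , trans (sym (ℚ.*-assoc K 1/K ε))
        (trans (cong (ℚ._* ε) (ℚ.*-inverseʳ K)) (ℚ.*-identityˡ ε))
    where
    instance
      K-pos : ℚ.Positive K
      K-pos = ℚ.positive K>0
      K-nonZero : ℚ.NonZero K
      K-nonZero = ℚ.pos⇒nonZero K
    1/K : ℚ
    1/K = 1/ K

  *-bound : ∀ p q {K δ} → ∣ p ∣ ℚ.≤ K → ∣ q ∣ ℚ.≤ δ → ∣ p ℚ.* q ∣ ℚ.≤ K ℚ.* δ
  *-bound p q {K} {δ} p≤K q≤δ = begin
    ∣ p ℚ.* q ∣       ≡⟨ ℚ.∣p*q∣≡∣p∣*∣q∣ p q ⟩
    ∣ p ∣ ℚ.* ∣ q ∣   ≤⟨ ℚ.*-monoʳ-≤-nonNeg ∣ q ∣ ⦃ ℚ.nonNegative (ℚ.0≤∣p∣ q) ⦄ p≤K ⟩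
    K ℚ.* ∣ q ∣       ≤⟨ ℚ.*-monoˡ-≤-nonNeg K ⦃ ℚ.nonNegative (ℚ.≤-trans (ℚ.0≤∣p∣ p) p≤K) ⦄ q≤δ ⟩
    K ℚ.* δ           ∎

_*ʳ_ : ℝ → ℝ → ℝ
x *ʳ y = (λ n → seq x n ℚ.* seq y n) , λ ε ε>0 →
  let K , K>0 , N₁ , x≤K = eventuallyBounded x
      L , L>0 , N₂ , y≤L = eventuallyBounded y
      δ , δ>0 , [K+L]δ≡ε = shrink (K ℚ.+ L) ε (ℚ.+-mono-< K>0 L>0) ε>0
      N₃ , close₃ = cauchy x δ δ>0
      N₄ , close₄ = cauchy y δ δ>0
      N₁₂ = N₁ ℕ.⊔ N₂
      N₃₄ = N₃ ℕ.⊔ N₄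
  in N₁₂ ℕ.⊔ N₃₄ , λ m n N≤m N≤n → begin
    ∣ seq x m ℚ.* seq y m ℚ.- seq x n ℚ.* seq y n ∣
      ≡⟨ cong ∣_∣ (split-product (seq x m) (seq y m) (seq x n) (seq y n)) ⟩
    ∣ seq x m ℚ.* (seq y m ℚ.- seq y n) ℚ.+ seq y n ℚ.* (seq x m ℚ.- seq x n) ∣
      ≤⟨ ℚ.∣p+q∣≤∣p∣+∣q∣ (seq x m ℚ.* (seq y m ℚ.- seq y n)) (seq y n ℚ.* (seq x m ℚ.- seq x n)) ⟩
    ∣ seq x m ℚ.* (seq y m ℚ.- seq y n) ∣ ℚ.+ ∣ seq y n ℚ.* (seq x m ℚ.- seq x n) ∣
      ≤⟨ ℚ.+-mono-≤
           (*-bound (seq x m) (seq y m ℚ.- seq y n) (x≤K m (l N₁ N₂ (l N₁₂ N₃₄ N≤m)))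
             (close₄ m n (r N₃ N₄ (r N₁₂ N₃₄ N≤m)) (r N₃ N₄ (r N₁₂ N₃₄ N≤n))))
           (*-bound (seq y n) (seq x m ℚ.- seq x n) (y≤L n (r N₁ N₂ (l N₁₂ N₃₄ N≤n)))
             (close₃ m n (l N₃ N₄ (r N₁₂ N₃₄ N≤m)) (l N₃ N₄ (r N₁₂ N₃₄ N≤n)))) ⟩
    K ℚ.* δ ℚ.+ L ℚ.* δ
      ≡⟨ sym (ℚ.*-distribʳ-+ δ K L) ⟩
    (K ℚ.+ L) ℚ.* δ
      ≡⟨ [K+L]δ≡ε ⟩
    ε ∎

Var : Set
Var = ℕ

infixr 6 _∧_

data Constraint : Set where
  true false : Constraint
  -- atomic ((a₁ , x₁) ∷ … ∷ (aₙ , xₙ) ∷ []) a  is  a₁ x₁ + … + aₙ xₙ ≤ a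
  atomic     : List (ℝ × Var) → ℝ → Constraint
  _∧_        : Constraint → Constraint → Constraint

varsᶜ : Constraint → List Var
varsᶜ true          = []
varsᶜ false         = []
varsᶜ (atomic as _) = map proj₂ as
varsᶜ (c ∧ d)       = varsᶜ c ++ varsᶜ d

renameᶜ : (Var → Var) → Constraint → Constraint
renameᶜ ρ true          = true
renameᶜ ρ false         = false
renameᶜ ρ (atomic as a) = atomic (map (map₂ ρ) as) a
renameᶜ ρ (c ∧ d)       = renameᶜ ρ c ∧ renameᶜ ρ d

Valuation : Set
Valuation = Var → ℝ

linear : List (ℝ × Var) → Valuation → ℝ
linear as σ = foldr (λ (a , x) s → a *ʳ σ x +ʳ s) 0ʳ as

infix 4 _⊨ᶜ_ _⊑_

_⊨ᶜ_ : Valuation → Constraint → Set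
σ ⊨ᶜ true        = ⊤
σ ⊨ᶜ false       = ⊥
σ ⊨ᶜ atomic as a = linear as σ ≤ʳ a
σ ⊨ᶜ c ∧ d       = (σ ⊨ᶜ c) × (σ ⊨ᶜ d)

Satisfiableᶜ : Constraint → Set
Satisfiableᶜ c = ∃[ σ ] σ ⊨ᶜ c

Unsatisfiableᶜ : Constraint → Set
Unsatisfiableᶜ c = ¬ Satisfiableᶜ c

_⊑_ : Constraint → Constraint → Set
c ⊑ d = ∀ σ → σ ⊨ᶜ c → σ ⊨ᶜ d

-- σ satisfies ∃ Y. c
_⊨∃_∙_ : Valuation → List Var → Constraint → Set
σ ⊨∃ Y ∙ c = ∃[ τ ] (∀ x → x ∉ Y → τ x ≡ σ x) × τ ⊨ᶜ c

_∖_ : List Var → List Var → List Var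
Y ∖ X = filter (λ y → ¬? (y ∈? X)) Y

-- scan _∙_ y i  is  (… (y₀ ∙ y₁) ∙ …) ∙ yᵢ
scan : ∀ {a} {A : Set a} → (A → A → A) → (ℕ → A) → ℕ → A
scan _∙_ y 0       = y 0
scan _∙_ y (suc i) = scan _∙_ y i ∙ y (suc i)

record AbstractDomain ℓ : Set (lsuc ℓ) where
  infixl 6 _⊔_ _∇_
  infixl 7 _⇓_
  field
    D       : Pred Constraint ℓ
    true∈D  : D true
    false∈D : D false
    ∧∈D     : ∀ {c d} → D c → D d → D (c ∧ d)

  DConstraint : Set ℓ
  DConstraint = [ c ∈ Constraint ∣ D c ]

  infix 4 _⊑ᴰ_
  _⊑ᴰ_ : DConstraint → DConstraint → Set
  c ⊑ᴰ d = value c ⊑ value d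

  field
    _⊔_       : DConstraint → DConstraint → DConstraint
    ⊔-upperˡ  : ∀ c d → c ⊑ᴰ c ⊔ d
    ⊔-upperʳ  : ∀ c d → d ⊑ᴰ c ⊔ d
    ⊔-least   : ∀ c d e → c ⊑ᴰ e → d ⊑ᴰ e → c ⊔ d ⊑ᴰ e

    _∇_       : DConstraint → DConstraint → DConstraint
    ∇-upperˡ  : ∀ c d → c ⊑ᴰ c ∇ d
    ∇-upperʳ  : ∀ c d → d ⊑ᴰ c ∇ d

    -- The increasing chain  scan _∇_ y  is finite: up to equivalence it is
    -- eventually constant.
    ∇-finite  : ∀ y → (∀ i → y i ⊑ᴰ y (suc i)) →
                ∃[ n ] (∀ m → n ℕ.≤ m → scan _∇_ y m ⊑ᴰ scan _∇_ y n)

    α         : Constraint → DConstraint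
    α-upper   : ∀ c → c ⊑ value (α c)
    α-least   : ∀ c (e : DConstraint) → c ⊑ value e → α c ⊑ᴰ e

    _⇓_       : DConstraint → List Var → DConstraint
    ⇓-vars    : ∀ c X → varsᶜ (value (c ⇓ X)) ⊆ X
    ⇓-∃       : ∀ c X σ →
                (σ ⊨ᶜ value (c ⇓ X)) ⇔ (σ ⊨∃ (varsᶜ (value c) ∖ X) ∙ value c)

-- a name together with an arity
PredSym : Set
PredSym = ℕ × ℕ

arity : PredSym → ℕ
arity = proj₂

_≟ᵖ_ : DecidableEquality PredSym
_≟ᵖ_ = Product.≡-dec ℕ._≟_ ℕ._≟_

record Atom : Set where
  constructor atom
  field
    pred : PredSym
    args : Vec Var (arity pred)

  argList : List Var
  argList = Vec.toList args

open Atom public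

infix 3 _←_,_

record Clause : Set where
  constructor _←_,_
  field
    head       : Maybe Atom   -- nothing is the head false
    constraint : Constraint
    body       : List Atom

open Clause public

headPred : Clause → Maybe PredSym
headPred K = Maybe.map pred (head K)

varsᵍ : List Atom → List Var
varsᵍ = concatMap argList

vars : Clause → List Var
vars K = maybe′ argList [] (head K) ++ varsᶜ (constraint K) ++ varsᵍ (body K)

preds : Clause → List PredSym
preds K = maybe′ (λ A → [ pred A ]) [] (head K) ++ map pred (body K)

record WellFormed (K : Clause) : Set where
  field
    head-distinct : ∀ {A} → head K ≡ just A → Unique (argList A)
    body-distinct : All (Unique ∘ argList) (body K)
    body-disjoint : AllPairs (λ A B → Disjoint (argList A) (argList B)) (body K)

renameᵃ : (Var → Var) → Atom → Atom
renameᵃ ρ (atom p xs) = atom p (Vec.map ρ xs)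

rename : Var ↔ Var → Clause → Clause
rename ρ (H ← c , G) =
  Maybe.map (renameᵃ (Inverse.to ρ)) H ← renameᶜ (Inverse.to ρ) c , map (renameᵃ (Inverse.to ρ)) G

HeadNotIn : Clause → List Clause → Set
HeadNotIn C P = ∀ {A} → head C ≡ just A → pred A ∉ concatMap preds P

record Interpretation : Set₁ where
  field
    rel      : (p : PredSym) → Vec ℝ (arity p) → Set
    rel-resp : ∀ p {xs ys} → VecPointwise.Pointwise _≃_ xs ys → rel p xs → rel p ys

open Interpretation public

_,_⊨ᵃ_ : Interpretation → Valuation → Atom → Set
M , σ ⊨ᵃ A = rel M (pred A) (Vec.map σ (args A))

_⊨_ : Interpretation → Clause → Set
M ⊨ (H ← c , G) =
  ∀ σ → σ ⊨ᶜ c → All (M , σ ⊨ᵃ_) G → maybe′ (M , σ ⊨ᵃ_) ⊥ H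

Satisfiable : List Clause → Set₁
Satisfiable S = ∃[ M ] All (M ⊨_) S

record UnfoldingVariant (C : Clause) (A : Atom) (K K′ : Clause) : Set where
  field
    var-renaming : Var ↔ Var
    renamed      : K′ ≡ rename var-renaming K
    head-is-A    : head K′ ≡ just A
    apart        : ∀ {x} → x ∈ vars K′ → x ∈ vars C → x ∈ argList A

clausesFor : PredSym → List Clause → List Clause
clausesFor p = filter (λ K → Maybe.≡-dec _≟ᵖ_ (headPred K) (just p))

-- Ks are all the clauses of P with head A, suitably renamed.
UnfoldingClauses : List Clause → Clause → Atom → List Clause → Set
UnfoldingClauses P C A Ks = Pointwise (UnfoldingVariant C A) (clausesFor (pred A) P) Ks

-- U is obtained from  H ← c , L , R  by unfolding, one after the other,
-- all the atoms of R.
data Unfold (P : List Clause) (H : Maybe Atom) :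
            (c : Constraint) (L R : List Atom) (U : List Clause) → Set where
  done   : ∀ {c L} → Unfold P H c L [] [ H ← c , L ]
  unfold : ∀ {c L A R Ks Us} →
           UnfoldingClauses P (H ← c , L ++ A ∷ R) A Ks →
           Pointwise (λ K U → Unfold P H (c ∧ constraint K) (L ++ body K) R U) Ks Us →
           Unfold P H c L (A ∷ R) (concat Us)

UnfoldBody : List Clause → Clause → List Clause → Set
UnfoldBody P C U = Unfold P (head C) (constraint C) [] (body C) U

Deletion : List Clause → List Clause → Set
Deletion U U′ = ∃[ deleted ] Interleaving U′ deleted U
  × All (Unsatisfiableᶜ ∘ constraint) deleted
  × All (¬_ ∘ Unsatisfiableᶜ ∘ constraint) U′

-- Subconjunctions are nonempty, so only an empty body is split into no
-- subconjunction at all.  (Folding the empty conjunction is unsound: newp ← d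
-- would be turned into newp ← d , newp.)
record PartitionOperator : Set where
  field
    partition   : Clause → List (List⁺ Atom)
    partition-↭ : ∀ E → concatMap List⁺.toList (partition E) ↭ body E

record State : Set where
  field
    inCls     : List Clause
    defs      : List Clause
    parents   : List (Clause × Clause)   -- pairs (parent , child)
    transfCls : List Clause

open State public

initial : List Clause → Clause → State
initial P C = record
  { inCls = [ C ] ; defs = [ C ] ; parents = [] ; transfCls = P }

Ancestor : State → Clause → Clause → Set
Ancestor s = Star (λ K K′ → (K , K′) ∈ parents s)

Enumerates : Atom → List Atom → Set
Enumerates A G = Unique (argList A) × argList A ⊆ varsᵍ G × varsᵍ G ⊆ argList A

-- Up to renaming of its variables and reordering of its body, K is the clause
-- A ← e , G, where the arguments of A are the variables of G in some order.
record HasForm (K : Clause) (A : Atom) (e : Constraint) (G : List Atom) : Set where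
  field
    var-renaming : Var ↔ Var
    head-≡       : head (rename var-renaming K) ≡ just A
    constraint-≡ : constraint (rename var-renaming K) ≡ e
    body-↭       : body (rename var-renaming K) ↭ G
    enumerates   : Enumerates A G

module Strategy {ℓ} (𝔻 : AbstractDomain ℓ) (Π : PartitionOperator) (P : List Clause) where

  open AbstractDomain 𝔻
  open PartitionOperator Π

  Fresh : PredSym → State → Set
  Fresh p s = p ∉ concatMap preds (P ++ defs s ++ transfCls s)

  addDefinition : Clause → Clause → State → State
  addDefinition C K s = record s
    { inCls = K ∷ inCls s ; defs = K ∷ defs s ; parents = (C , K) ∷ parents s }

  -- An ancestor of C of the form newq(V) ← f , G.  The constraint of the root
  -- need not be in D, in which case ∇ does not apply and the root does not match.
  WideningAncestor : State → Clause → List Atom → DConstraint → Set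
  WideningAncestor s C G f = ∃[ K ] ∃[ A ] K ∈ defs s × Ancestor s K C × HasForm K A (value f) G

  module _ (C : Clause) (d : Constraint) where

    projected : List Atom → DConstraint
    projected G = α d ⇓ varsᵍ G

    Foldable : State → List Atom → Atom → Set
    Foldable s G A = ∃[ K ] ∃[ e ] K ∈ defs s × HasForm K A e G × value (projected G) ⊑ e

    -- The subconjunction G of  H ← d , G₁ , … , Gₙ  is folded into the atom A.
    data FoldPart (G : List Atom) (s : State) : Atom → State → Set ℓ where
      reuse : ∀ {A} → Foldable s G A → FoldPart G s A s
      widen : ∀ {A f} → ¬ ∃ (Foldable s G) → WideningAncestor s C G f →
              Fresh (pred A) s → Enumerates A G →
              FoldPart G s A (addDefinition C (just A ← value (f ∇ (f ⊔ projected G)) , G) s)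
      plain : ∀ {A} → ¬ ∃ (Foldable s G) → ¬ ∃ (WideningAncestor s C G) →
              Fresh (pred A) s → Enumerates A G →
              FoldPart G s A (addDefinition C (just A ← value (projected G) , G) s)

    data FoldParts : List (List⁺ Atom) → State → List Atom → State → Set ℓ where
      []  : ∀ {s} → FoldParts [] s [] s
      _∷_ : ∀ {G Gs s s′ s″ A As} →
            FoldPart (List⁺.toList G) s A s′ → FoldParts Gs s′ As s″ →
            FoldParts (G ∷ Gs) s (A ∷ As) s″

  data FoldClauses (C : Clause) : List Clause → State → State → Set ℓ where
    []   : ∀ {s} → FoldClauses C [] s s
    fold : ∀ {U E As s s′ s″} (E∈U : E ∈ U) →
           FoldParts C (constraint E) (partition E) s As s′ →
           FoldClauses C (U ─ E∈U)
             (record s′ { transfCls = (head E ← constraint E , As) ∷ transfCls s′ }) s″ →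
           FoldClauses C U s s″

  data Iteration (s : State) : State → Set ℓ where
    iteration : ∀ {C U U′ s′} → C ∈ inCls s →
                UnfoldBody P C U → Deletion U U′ → FoldClauses C U′ s s′ →
                (C∈s′ : C ∈ inCls s′) →
                Iteration s (record s′ { inCls = inCls s′ ─ C∈s′ })

  -- On input P ∪ {C} the strategy may terminate returning T.
  Returns : Clause → List Clause → Set ℓ
  Returns C T = ∃[ s ] Star Iteration (initial P C) s × inCls s ≡ [] × transfCls s ≡ T

-- If the head of C is an atom, then P ∪ {C} is satisfiable as soon as P is, since
-- the head predicate can be made true everywhere.  The other cases rest on two
-- constructions.
--   From a model M of P ∪ {C}: interpret each new predicate by the body of its
-- definition in M.  An atom newpᵢ(Vᵢ) of a folded clause then yields Gᵢ, and a
-- clause obtained by unfolding is a consequence of P and the definition it comes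
-- from.
--   From a model M of TransfCls, when the head of C is false: by induction on n, if
-- the body of a definition has derivations from P of height at most n + 1, then M
-- satisfies its head.  Unfolding every atom of the body once lowers the height to n.
-- Folding replaces subconjunctions by heads of definitions whose constraints are
-- implied by d (as d ⊑ dᵢ, and d ⊑ aᵢ in the case of widening), so the induction
-- hypothesis applies to them.  With C as the definition, the least model of P
-- satisfies C.

module Submission where

open import Defs
open import Data.Empty using (⊥; ⊥-elim)
open import Data.List.Base using (List; []; _∷_; [_]; _++_; concat; concatMap; map)
open import Data.List.Membership.DecPropositional using () renaming (_∈?_ to member?)
open import Data.List.Membership.Propositional using (_∈_; _∉_)
open import Data.List.Membership.Propositional.Properties
  using (∈-map⁺; ∈-++⁺ˡ; ∈-++⁺ʳ; ∈-++⁻; ∈-concatMap⁺; ∈-filter⁺; ∈-filter⁻)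
open import Data.List.NonEmpty.Base as List⁺ using (List⁺; _∷_)
open import Data.List.Properties using (map-id; map-id-local)
open import Data.List.Relation.Binary.Permutation.Propositional using (↭-reflexive; ↭-sym)
open import Data.List.Relation.Binary.Permutation.Propositional.Properties
  using (All-resp-↭; ∈-resp-↭)
open import Data.List.Relation.Binary.Pointwise.Base as Pointwise using (Pointwise; []; _∷_)
open import Data.List.Relation.Binary.Subset.Propositional using (_⊆_)
open import Data.List.Relation.Binary.Subset.Propositional.Properties
  using (concatMap⁺; xs⊆xs++ys; xs⊆ys++xs)
open import Data.List.Relation.Ternary.Interleaving.Propositional using (toPermutation)
open import Data.List.Relation.Unary.All as All using (All; []; _∷_)
import Data.List.Relation.Unary.All.Properties as All
open import Data.List.Relation.Unary.Any as Any using (here; there; _─_)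
import Data.List.Relation.Unary.Any.Properties as Any
open import Data.Maybe.Base as Maybe using (Maybe; just; nothing; maybe′)
open import Data.Nat.Base as ℕ using (ℕ; zero; suc)
import Data.Nat.Properties as ℕ
open import Data.Product.Base using (∃-syntax; _×_; _,_; proj₁; proj₂; map₂)
open import Data.Rational.Base as ℚ using (0ℚ; ½; 1/_; ∣_∣)
import Data.Rational.Properties as ℚ
open import Data.Rational.Solver using (module +-*-Solver)
open import Data.Refinement.Base using (value)
open import Data.Sum.Base using (_⊎_; inj₁; inj₂; [_,_]′)
open import Data.Unit.Base using (tt)
open import Data.Vec.Base as Vec using (Vec)
import Data.Vec.Properties as Vec
open import Data.Vec.Relation.Binary.Pointwise.Inductive as Vecʳ using ([]; _∷_)
open import Function.Base using (id; _∘_)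
open import Function.Bundles using (_⇔_; mk⇔; _↔_; module Equivalence; module Inverse)
open import Function.Construct.Identity using (↔-id)
open import Relation.Binary.Construct.Closure.ReflexiveTransitive as Star using (Star)
open import Relation.Binary.PropositionalEquality
  using (_≡_; _≢_; refl; sym; trans; cong; cong₂; subst)
open import Relation.Nullary.Decidable using (yes; no)
open import Relation.Nullary.Negation using (contradiction)

open Inverse using (to; from; strictlyInverseʳ)

-- Congruence of the reals

private
  module S = +-*-Solver
  open ℚ.≤-Reasoning

  half-pos : ∀ {ε} → 0ℚ ℚ.< ε → 0ℚ ℚ.< ½ ℚ.* ε
  half-pos {ε} ε>0 = ℚ.positive⁻¹ _ ⦃ ℚ.pos*pos⇒pos ½ ε ⦃ ℚ.positive ε>0 ⦄ ⦄

  half+half : ∀ ε → ½ ℚ.* ε ℚ.+ ½ ℚ.* ε ≡ ε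
  half+half ε = trans (sym (ℚ.*-distribʳ-+ ε ½ ½)) (ℚ.*-identityˡ ε)

  divide : ∀ K ε → 0ℚ ℚ.< K → 0ℚ ℚ.< ε → ∃[ δ ] 0ℚ ℚ.< δ × K ℚ.* δ ≡ ε
  divide K ε K>0 ε>0 = 1/ K ℚ.* ε
    , ℚ.positive⁻¹ _ ⦃ ℚ.pos*pos⇒pos (1/ K) ⦃ ℚ.1/pos⇒pos K ⦄ ε ⦃ ℚ.positive ε>0 ⦄ ⦄
    , trans (sym (ℚ.*-assoc K (1/ K) ε))
        (trans (cong (ℚ._* ε) (ℚ.*-inverseʳ K)) (ℚ.*-identityˡ ε))
    where
    instance
      K-pos : ℚ.Positive K
      K-pos = ℚ.positive K>0
      K-nonZero : ℚ.NonZero K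
      K-nonZero = ℚ.pos⇒nonZero K

  difference≤ : ∀ {p q δ} → p ℚ.≤ q ℚ.+ δ → p ℚ.- q ℚ.≤ δ
  difference≤ {p} {q} {δ} p≤q+δ = begin
    p ℚ.- q             ≤⟨ ℚ.+-monoˡ-≤ (ℚ.- q) p≤q+δ ⟩
    q ℚ.+ δ ℚ.- q       ≡⟨ S.solve 2 (λ q δ → q S.:+ δ S.:- q S.:= δ) refl q δ ⟩
    δ                   ∎

  ∣difference∣≤ : ∀ {p q δ} → p ℚ.≤ q ℚ.+ δ → q ℚ.≤ p ℚ.+ δ → ∣ p ℚ.- q ∣ ℚ.≤ δ
  ∣difference∣≤ {p} {q} {δ} p≤q+δ q≤p+δ with ℚ.∣p∣≡p∨∣p∣≡-p (p ℚ.- q)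
  ... | inj₁ eq = ℚ.≤-trans (ℚ.≤-reflexive eq) (difference≤ p≤q+δ)
  ... | inj₂ eq = ℚ.≤-trans
    (ℚ.≤-reflexive (trans eq (S.solve 2 (λ p q → S.:- (p S.:- q) S.:= q S.:- p) refl p q)))
    (difference≤ q≤p+δ)

  p≤∣p∣ : ∀ p → p ℚ.≤ ∣ p ∣
  p≤∣p∣ p with ℚ.≤-total 0ℚ p
  ... | inj₁ 0≤p = ℚ.≤-reflexive (sym (ℚ.0≤p⇒∣p∣≡p 0≤p))
  ... | inj₂ p≤0 = ℚ.≤-trans p≤0 (ℚ.0≤∣p∣ p)

≤ʳ-refl : ∀ {x} → x ≤ʳ x
≤ʳ-refl {x} ε ε>0 = 0 , λ n _ →
  ℚ.≤-trans (ℚ.≤-reflexive (sym (ℚ.+-identityʳ (seq x n)))) (ℚ.+-monoʳ-≤ (seq x n) (ℚ.<⇒≤ ε>0))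

≤ʳ-trans : ∀ {x y z} → x ≤ʳ y → y ≤ʳ z → x ≤ʳ z
≤ʳ-trans {x} {y} {z} x≤y y≤z ε ε>0 with x≤y _ (half-pos ε>0) | y≤z _ (half-pos ε>0)
... | N₁ , xy | N₂ , yz = N₁ ℕ.⊔ N₂ , λ n N≤n → begin
  seq x n                                  ≤⟨ xy n (ℕ.m⊔n≤o⇒m≤o N₁ N₂ N≤n) ⟩
  seq y n ℚ.+ ½ ℚ.* ε                      ≤⟨ ℚ.+-monoˡ-≤ (½ ℚ.* ε) (yz n (ℕ.m⊔n≤o⇒n≤o N₁ N₂ N≤n)) ⟩
  seq z n ℚ.+ ½ ℚ.* ε ℚ.+ ½ ℚ.* ε          ≡⟨ ℚ.+-assoc (seq z n) _ _ ⟩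
  seq z n ℚ.+ (½ ℚ.* ε ℚ.+ ½ ℚ.* ε)        ≡⟨ cong (seq z n ℚ.+_) (half+half ε) ⟩
  seq z n ℚ.+ ε                            ∎

+ʳ-mono-≤ʳ : ∀ {x x′ y y′} → x ≤ʳ x′ → y ≤ʳ y′ → x +ʳ y ≤ʳ x′ +ʳ y′
+ʳ-mono-≤ʳ {x} {x′} {y} {y′} x≤x′ y≤y′ ε ε>0 with x≤x′ _ (half-pos ε>0) | y≤y′ _ (half-pos ε>0)
... | N₁ , xx′ | N₂ , yy′ = N₁ ℕ.⊔ N₂ , λ n N≤n → begin
  seq x n ℚ.+ seq y n
    ≤⟨ ℚ.+-mono-≤ (xx′ n (ℕ.m⊔n≤o⇒m≤o N₁ N₂ N≤n)) (yy′ n (ℕ.m⊔n≤o⇒n≤o N₁ N₂ N≤n)) ⟩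
  (seq x′ n ℚ.+ ½ ℚ.* ε) ℚ.+ (seq y′ n ℚ.+ ½ ℚ.* ε)
    ≡⟨ S.solve 3 (λ a b h → (a S.:+ h) S.:+ (b S.:+ h) S.:= a S.:+ b S.:+ (h S.:+ h)) refl
         (seq x′ n) (seq y′ n) (½ ℚ.* ε) ⟩
  seq x′ n ℚ.+ seq y′ n ℚ.+ (½ ℚ.* ε ℚ.+ ½ ℚ.* ε)
    ≡⟨ cong (seq x′ n ℚ.+ seq y′ n ℚ.+_) (half+half ε) ⟩
  seq x′ n ℚ.+ seq y′ n ℚ.+ ε ∎

-- The sign of `a` is unknown, so `x` and `y` must be close from both sides. Since `∣ a ∣` is
-- eventually at most `K`, a tolerance `δ` with `K δ = ε` works.
*ʳ-congˡ-≤ʳ : ∀ a {x y} → x ≃ y → a *ʳ x ≤ʳ a *ʳ y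
*ʳ-congˡ-≤ʳ a {x} {y} (x≤y , y≤x) ε ε>0 =
  let K , K>0 , N₀ , a≤K = eventuallyBounded a
      δ , δ>0 , Kδ≡ε = divide K ε K>0 ε>0
      N₁ , xy = x≤y δ δ>0
      N₂ , yx = y≤x δ δ>0
  in N₀ ℕ.⊔ (N₁ ℕ.⊔ N₂) , λ n N≤n →
    let N₁₂≤n = ℕ.m⊔n≤o⇒n≤o N₀ (N₁ ℕ.⊔ N₂) N≤n
        p = seq a n
        d = seq x n ℚ.- seq y n
        p≤K = a≤K n (ℕ.m⊔n≤o⇒m≤o N₀ (N₁ ℕ.⊔ N₂) N≤n)
    in begin
    p ℚ.* seq x n
      ≡⟨ S.solve 3 (λ p x y → p S.:* x S.:= p S.:* y S.:+ p S.:* (x S.:- y)) refl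
           p (seq x n) (seq y n) ⟩
    p ℚ.* seq y n ℚ.+ p ℚ.* d
      ≤⟨ ℚ.+-monoʳ-≤ (p ℚ.* seq y n) (begin
           p ℚ.* d          ≤⟨ p≤∣p∣ (p ℚ.* d) ⟩
           ∣ p ℚ.* d ∣      ≡⟨ ℚ.∣p*q∣≡∣p∣*∣q∣ p d ⟩
           ∣ p ∣ ℚ.* ∣ d ∣  ≤⟨ ℚ.*-monoʳ-≤-nonNeg ∣ d ∣ ⦃ ℚ.nonNegative (ℚ.0≤∣p∣ d) ⦄ p≤K ⟩
           K ℚ.* ∣ d ∣      ≤⟨ ℚ.*-monoˡ-≤-nonNeg K ⦃ ℚ.nonNegative (ℚ.<⇒≤ K>0) ⦄
                                (∣difference∣≤ (xy n (ℕ.m⊔n≤o⇒m≤o N₁ N₂ N₁₂≤n))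
                                               (yx n (ℕ.m⊔n≤o⇒n≤o N₁ N₂ N₁₂≤n))) ⟩
           K ℚ.* δ          ≡⟨ Kδ≡ε ⟩
           ε                ∎) ⟩
    p ℚ.* seq y n ℚ.+ ε ∎

≃-refl : ∀ {x} → x ≃ x
≃-refl {x} = ≤ʳ-refl {x} , ≤ʳ-refl {x}

≃-sym : ∀ {x y} → x ≃ y → y ≃ x
≃-sym (x≤y , y≤x) = y≤x , x≤y

≃-trans : ∀ {x y z} → x ≃ y → y ≃ z → x ≃ z
≃-trans {x} {y} {z} (x≤y , y≤x) (y≤z , z≤y) =
  ≤ʳ-trans {x} {y} {z} x≤y y≤z , ≤ʳ-trans {z} {y} {x} z≤y y≤x

≃-reflexive : ∀ {x y} → x ≡ y → x ≃ y
≃-reflexive {x} refl = ≃-refl {x}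

+ʳ-cong : ∀ {x x′ y y′} → x ≃ x′ → y ≃ y′ → x +ʳ y ≃ x′ +ʳ y′
+ʳ-cong {x} {x′} {y} {y′} (x≤x′ , x′≤x) (y≤y′ , y′≤y) =
  +ʳ-mono-≤ʳ {x} {x′} {y} {y′} x≤x′ y≤y′ , +ʳ-mono-≤ʳ {x′} {x} {y′} {y} x′≤x y′≤y

*ʳ-congˡ : ∀ a {x y} → x ≃ y → a *ʳ x ≃ a *ʳ y
*ʳ-congˡ a {x} {y} x≃y = *ʳ-congˡ-≤ʳ a {x} {y} x≃y , *ʳ-congˡ-≤ʳ a {y} {x} (≃-sym {x} {y} x≃y)

-- Valuations and renamings

-- Agreement is up to `≃` because an instance of a clause head matches a tuple of reals only up to
-- `≃`.
Agree : Valuation → Valuation → List Var → Set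
Agree σ τ X = ∀ {x} → x ∈ X → σ x ≃ τ x

agree-sym : ∀ {σ τ X} → Agree σ τ X → Agree τ σ X
agree-sym {σ} {τ} σ≈τ {x} x∈X = ≃-sym {σ x} {τ x} (σ≈τ x∈X)

linear-agree : ∀ as {σ τ} → Agree σ τ (map proj₂ as) → linear as σ ≃ linear as τ
linear-agree []             σ≈τ = ≃-refl {0ʳ}
linear-agree ((a , x) ∷ as) {σ} {τ} σ≈τ =
  +ʳ-cong {a *ʳ σ x} {a *ʳ τ x} {linear as σ} {linear as τ}
    (*ʳ-congˡ a {σ x} {τ x} (σ≈τ (here refl))) (linear-agree as {σ} {τ} (σ≈τ ∘ there))

⊨ᶜ-agree : ∀ c {σ τ} → Agree σ τ (varsᶜ c) → σ ⊨ᶜ c → τ ⊨ᶜ c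
⊨ᶜ-agree true          _   _       = tt
⊨ᶜ-agree (atomic as a) {σ} {τ} σ≈τ σ⊨c =
  ≤ʳ-trans {linear as τ} {linear as σ} {a} (proj₂ (linear-agree as {σ} {τ} σ≈τ)) σ⊨c
⊨ᶜ-agree (c ∧ d)       {σ} {τ} σ≈τ (p , q) =
  ⊨ᶜ-agree c {σ} {τ} (σ≈τ ∘ ∈-++⁺ˡ) p , ⊨ᶜ-agree d {σ} {τ} (σ≈τ ∘ ∈-++⁺ʳ (varsᶜ c)) q

linear-rename : ∀ ρ as {σ τ} → (∀ x → σ (ρ x) ≃ τ x) → linear (map (map₂ ρ) as) σ ≃ linear as τ
linear-rename ρ []             σρ≈τ = ≃-refl {0ʳ}
linear-rename ρ ((a , x) ∷ as) {σ} {τ} σρ≈τ =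
  +ʳ-cong {a *ʳ σ (ρ x)} {a *ʳ τ x} {linear (map (map₂ ρ) as) σ} {linear as τ}
    (*ʳ-congˡ a {σ (ρ x)} {τ x} (σρ≈τ x)) (linear-rename ρ as {σ} {τ} σρ≈τ)

⊨ᶜ-rename⁻ : ∀ ρ c {σ τ} → (∀ x → σ (ρ x) ≃ τ x) → σ ⊨ᶜ renameᶜ ρ c → τ ⊨ᶜ c
⊨ᶜ-rename⁻ ρ true          _ _ = tt
⊨ᶜ-rename⁻ ρ (atomic as a) {σ} {τ} σρ≈τ = ≤ʳ-trans {linear as τ} {linear (map (map₂ ρ) as) σ} {a}
  (proj₂ (linear-rename ρ as {σ} {τ} σρ≈τ))
⊨ᶜ-rename⁻ ρ (c ∧ d)       {σ} {τ} σρ≈τ (p , q) =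
  ⊨ᶜ-rename⁻ ρ c {σ} {τ} σρ≈τ p , ⊨ᶜ-rename⁻ ρ d {σ} {τ} σρ≈τ q

⊨ᶜ-rename⁺ : ∀ ρ c {σ τ} → (∀ x → σ (ρ x) ≃ τ x) → τ ⊨ᶜ c → σ ⊨ᶜ renameᶜ ρ c
⊨ᶜ-rename⁺ ρ true          _ _ = tt
⊨ᶜ-rename⁺ ρ (atomic as a) {σ} {τ} σρ≈τ = ≤ʳ-trans {linear (map (map₂ ρ) as) σ} {linear as τ} {a}
  (proj₁ (linear-rename ρ as {σ} {τ} σρ≈τ))
⊨ᶜ-rename⁺ ρ (c ∧ d)       {σ} {τ} σρ≈τ (p , q) =
  ⊨ᶜ-rename⁺ ρ c {σ} {τ} σρ≈τ p , ⊨ᶜ-rename⁺ ρ d {σ} {τ} σρ≈τ q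

⊨ᶜ-unrename : (ρ : Var ↔ Var) → ∀ c {τ} → τ ⊨ᶜ c → (τ ∘ from ρ) ⊨ᶜ renameᶜ (to ρ) c
⊨ᶜ-unrename ρ c {τ} = ⊨ᶜ-rename⁺ (to ρ) c {τ ∘ from ρ} {τ}
  (λ x → ≃-reflexive {τ (from ρ (to ρ x))} {τ x} (cong τ (strictlyInverseʳ ρ x)))

renameᶜ-id : ∀ c → renameᶜ id c ≡ c
renameᶜ-id true          = refl
renameᶜ-id false         = refl
renameᶜ-id (atomic as a) = cong (λ as → atomic as a) (map-id as)
renameᶜ-id (c ∧ d)       = cong₂ _∧_ (renameᶜ-id c) (renameᶜ-id d)

renameᵃ-id : ∀ A → renameᵃ id A ≡ A
renameᵃ-id (atom p xs) = cong (atom p) (Vec.map-id xs)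

agree⇒pointwise : ∀ {n} (xs : Vec Var n) {σ τ} → Agree σ τ (Vec.toList xs) →
                  Vecʳ.Pointwise _≃_ (Vec.map σ xs) (Vec.map τ xs)
agree⇒pointwise Vec.[]       σ≈τ = []
agree⇒pointwise (x Vec.∷ xs) σ≈τ = σ≈τ (here refl) ∷ agree⇒pointwise xs (σ≈τ ∘ there)

pointwise⇒agree : ∀ {n} (xs : Vec Var n) {σ τ} →
                  Vecʳ.Pointwise _≃_ (Vec.map σ xs) (Vec.map τ xs) → Agree σ τ (Vec.toList xs)
pointwise⇒agree (x Vec.∷ xs) (σx≃τx ∷ _)  (here refl)  = σx≃τx
pointwise⇒agree (x Vec.∷ xs) (_ ∷ σxs≃τxs) (there y∈xs) = pointwise⇒agree xs σxs≃τxs y∈xs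

map-unrename : (ρ : Var ↔ Var) (τ : Valuation) → ∀ {n} (xs : Vec Var n) →
              Vec.map (τ ∘ from ρ) (Vec.map (to ρ) xs) ≡ Vec.map τ xs
map-unrename ρ τ xs = trans (sym (Vec.map-∘ (τ ∘ from ρ) (to ρ) xs))
  (Vec.map-cong (λ x → cong τ (strictlyInverseʳ ρ x)) xs)

-- Atoms and clauses in a relation

-- An interpretation stripped of `rel-resp`, so that `Derivable n` and `defined` can be given first
-- and shown to respect `≃` afterwards.
Relation : Set₁
Relation = (p : PredSym) → Vec ℝ (arity p) → Set

Respects≃ : Relation → Set
Respects≃ R = ∀ p {xs ys} → Vecʳ.Pointwise _≃_ xs ys → R p xs → R p ys

-- M , σ ⊨ᵃ A  is  Holds (rel M) σ A.
Holds : Relation → Valuation → Atom → Set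
Holds R σ A = R (pred A) (Vec.map σ (args A))

holds-agree : ∀ {R} → Respects≃ R → ∀ A {σ τ} → Agree σ τ (argList A) → Holds R σ A → Holds R τ A
holds-agree resp A σ≈τ = resp (pred A) (agree⇒pointwise (args A) σ≈τ)

allHold-agree : ∀ {R} → Respects≃ R → ∀ G {σ τ} → Agree σ τ (varsᵍ G) →
                All (Holds R σ) G → All (Holds R τ) G
allHold-agree resp []      σ≈τ []       = []
allHold-agree resp (A ∷ G) {σ} {τ} σ≈τ (h ∷ hs) =
  holds-agree resp A {σ} {τ} (σ≈τ ∘ ∈-++⁺ˡ) h ∷ allHold-agree resp G (σ≈τ ∘ ∈-++⁺ʳ (argList A)) hs

holds-rename : ∀ R ρ A {σ} → Holds R σ (renameᵃ ρ A) ≡ Holds R (σ ∘ ρ) A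
holds-rename R ρ (atom p xs) {σ} = cong (R p) (sym (Vec.map-∘ σ ρ xs))

allHold-rename⁻ : ∀ R ρ {G σ} → All (Holds R σ) (map (renameᵃ ρ) G) → All (Holds R (σ ∘ ρ)) G
allHold-rename⁻ R ρ = All.map (λ {A} → subst id (holds-rename R ρ A)) ∘ All.map⁻

allHold-unrename : ∀ R (ρ : Var ↔ Var) {G τ} →
                  All (Holds R τ) G → All (Holds R (τ ∘ from ρ)) (map (renameᵃ (to ρ)) G)
allHold-unrename R ρ {τ = τ} =
  All.map⁺ ∘ All.map (λ {A} → subst (R (pred A)) (sym (map-unrename ρ τ (args A))))

HeadHolds : Relation → Valuation → Maybe Atom → Set
HeadHolds R σ = maybe′ (Holds R σ) ⊥

headHolds-agree : ∀ {R} → Respects≃ R → ∀ H {σ τ} → Agree σ τ (maybe′ argList [] H) →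
                  HeadHolds R σ H → HeadHolds R τ H
headHolds-agree resp (just A) {σ} {τ} σ≈τ = holds-agree resp A {σ} {τ} σ≈τ

headHolds-rename : ∀ R ρ H {σ} → HeadHolds R σ (Maybe.map (renameᵃ ρ) H) ≡ HeadHolds R (σ ∘ ρ) H
headHolds-rename R ρ (just A) = holds-rename R ρ A
headHolds-rename R ρ nothing  = refl

⊨-rename : ∀ M ρ K → M ⊨ K → M ⊨ rename ρ K
⊨-rename M ρ K M⊨K σ σ⊨c hs = subst id (sym (headHolds-rename (rel M) (to ρ) (head K)))
  (M⊨K (σ ∘ to ρ) (⊨ᶜ-rename⁻ (to ρ) (constraint K) {σ} {σ ∘ to ρ} (λ x → ≃-refl {σ (to ρ x)}) σ⊨c)
    (allHold-rename⁻ (rel M) (to ρ) hs))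

-- Matching on this family identifies the predicate of the head with `p`, and with it the lengths of
-- the two tuples. The head `nothing` has no instance.
data Instance (τ : Valuation) : Maybe Atom → Relation where
  inst : ∀ {p xs as} → Vecʳ.Pointwise _≃_ (Vec.map τ xs) as → Instance τ (just (atom p xs)) p as

instance-resp : ∀ {τ H} → Respects≃ (Instance τ H)
instance-resp p as≃bs (inst τxs≃as) =
  inst (Vecʳ.trans (λ {x} {y} {z} → ≃-trans {x} {y} {z}) τxs≃as as≃bs)

instance-pred : ∀ {τ K p as} → Instance τ (head K) p as → headPred K ≡ just p
instance-pred {K = _ ← _ , _} (inst _) = refl

instance-headHolds : ∀ {R} → Respects≃ R → ∀ {τ H p as} →
                     HeadHolds R τ H → Instance τ H p as → R p as
instance-headHolds resp h (inst τxs≃as) = resp _ τxs≃as h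

-- The original head under `τ` and `A` under `σ` denote the same tuple, and the renamed head is `A`.
-- Comparing the tuples position by position gives the agreement.
instance-agree : ∀ (ρ : Var ↔ Var) {τ σ H A} → Instance τ H (pred A) (Vec.map σ (args A)) →
                 Maybe.map (renameᵃ (to ρ)) H ≡ just A → Agree (τ ∘ from ρ) σ (argList A)
instance-agree ρ {τ} {σ} {A = atom p ys} (inst {xs = xs} τxs≃σys) refl =
  pointwise⇒agree ys (subst (λ as → Vecʳ.Pointwise _≃_ as (Vec.map σ ys))
    (sym (map-unrename ρ τ xs)) τxs≃σys)

∈-─ : ∀ {A : Set} {x y : A} {xs} → x ∈ xs → (y∈xs : y ∈ xs) → x ≡ y ⊎ x ∈ (xs ─ y∈xs)
∈-─ x∈xs y∈xs = All.lookup
  (All.─⁻ y∈xs (inj₁ (sym (Any.lookup-result y∈xs))) (All.tabulate inj₂)) x∈xs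

∈-lookupˡ : ∀ {A B : Set} {R : A → B → Set} {x xs ys} → Pointwise R xs ys → x ∈ xs →
            ∃[ y ] y ∈ ys × R x y
∈-lookupˡ (r ∷ rs) (here refl) = _ , here refl , r
∈-lookupˡ (r ∷ rs) (there x∈) with ∈-lookupˡ rs x∈
... | y , y∈ , r′ = y , there y∈ , r′

∈-lookupʳ : ∀ {A B : Set} {R : A → B → Set} {y xs ys} → Pointwise R xs ys → y ∈ ys →
            ∃[ x ] x ∈ xs × R x y
∈-lookupʳ (r ∷ rs) (here refl) = _ , here refl , r
∈-lookupʳ (r ∷ rs) (there y∈) with ∈-lookupʳ rs y∈
... | x , x∈ , r′ = x , there x∈ , r′

-- Unfolding

glue : List Var → Valuation → Valuation → Valuation
glue X τ σ x with member? ℕ._≟_ x X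
... | yes _ = τ x
... | no _  = σ x

glue-left : ∀ X τ σ → Agree (glue X τ σ) τ X
glue-left X τ σ {x} x∈X with member? ℕ._≟_ x X
... | yes _ = ≃-refl {τ x}
... | no x∉X = contradiction x∈X x∉X

glue-right : ∀ {X Y τ σ} → (∀ {x} → x ∈ X → x ∈ Y → τ x ≃ σ x) → Agree (glue X τ σ) σ Y
glue-right {X} {σ = σ} τ≈σ {x} x∈Y with member? ℕ._≟_ x X
... | yes x∈X = τ≈σ x∈X x∈Y
... | no _    = ≃-refl {σ x}

varsᶜ⊆vars : ∀ K → varsᶜ (constraint K) ⊆ vars K
varsᶜ⊆vars (H ← c , G) = ∈-++⁺ʳ (maybe′ argList [] H) ∘ ∈-++⁺ˡ

varsᵍ⊆vars : ∀ K {G} → G ⊆ body K → varsᵍ G ⊆ vars K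
varsᵍ⊆vars (H ← c , _) G⊆ = ∈-++⁺ʳ (maybe′ argList [] H) ∘ ∈-++⁺ʳ (varsᶜ c) ∘ concatMap⁺ argList G⊆

-- The valuation τ of K is moved to the variables of its variant K′ and glued to σ,
-- with which it agrees on the common variables, as these occur in A.
resolve : ∀ {R} → Respects≃ R → ∀ {C A K K′ σ τ} → UnfoldingVariant C A K K′ →
  Instance τ (head K) (pred A) (Vec.map σ (args A)) → τ ⊨ᶜ constraint K → All (Holds R τ) (body K) →
  ∃[ σ′ ] Agree σ′ σ (vars C) × σ′ ⊨ᶜ constraint K′ × All (Holds R σ′) (body K′)
resolve {R} resp {C} {A} {K} {_} {σ} {τ}
  record { var-renaming = ρ ; renamed = refl ; head-is-A = head≡A ; apart = apart } i τ⊨c hs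
  = σ′
  , glue-right {vars K′} {vars C} {τ′} {σ} (λ x∈K′ x∈C → instance-agree ρ i head≡A (apart x∈K′ x∈C))
  , ⊨ᶜ-agree (constraint K′) {τ′} {σ′} (τ′≈σ′ ∘ varsᶜ⊆vars K′)
      (⊨ᶜ-unrename ρ (constraint K) {τ} τ⊨c)
  , allHold-agree resp (body K′) {τ′} {σ′} (τ′≈σ′ ∘ varsᵍ⊆vars K′ id)
      (allHold-unrename R ρ hs)
  where
  K′ : Clause
  K′ = rename ρ K
  τ′ σ′ : Valuation
  τ′ = τ ∘ from ρ
  σ′ = glue (vars K′) τ′ σ
  τ′≈σ′ : Agree τ′ σ′ (vars K′)
  τ′≈σ′ = agree-sym {σ′} {τ′} (glue-left (vars K′) τ′ σ)

-- Soundness of unfolding in a model of `P`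

module _ (P : List Clause) (M : Interpretation) (M⊨P : All (M ⊨_) P) where

  -- Separating the atoms already produced, `L`, from those still to be unfolded, `R`, gives a
  -- property that passes through each single unfolding step.
  Unfolded : Maybe Atom → Constraint → List Atom → List Atom → Clause → Set
  Unfolded H c L R E = head E ≡ H × (∀ σ → σ ⊨ᶜ constraint E → All (Holds (rel M) σ) (body E) →
    σ ⊨ᶜ c × All (Holds (rel M) σ) L × All (Holds (rel M) σ) R)

  variant-sound : ∀ {C A K} → K ∈ P → ∀ {K′} → UnfoldingVariant C A K K′ →
                  ∀ σ → σ ⊨ᶜ constraint K′ → All (Holds (rel M) σ) (body K′) → Holds (rel M) σ A
  variant-sound {K = K} K∈P record { var-renaming = ρ ; renamed = refl ; head-is-A = h } σ σ⊨c hs =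
    subst (HeadHolds (rel M) σ) h (⊨-rename M ρ K (All.lookup M⊨P K∈P) σ σ⊨c hs)

  -- Since `M` satisfies `P`, the body of a variant with head `A` forces `A`. So each replaced atom
  -- is recovered from its replacement, under the same valuation.
  unfold-sound : ∀ {H c L R U E} → Unfold P H c L R U → E ∈ U → Unfolded H c L R E
  unfold-sound-all : ∀ {H c L R Ks Us E} →
    Pointwise (λ K U → Unfold P H (c ∧ constraint K) (L ++ body K) R U) Ks Us → E ∈ concat Us →
    ∃[ K ] K ∈ Ks × Unfolded H (c ∧ constraint K) (L ++ body K) R E

  unfold-sound done (here refl) = refl , λ σ σ⊨c hs → σ⊨c , hs , []
  unfold-sound {L = L} (unfold variants us) E∈ with unfold-sound-all us E∈
  ... | K′ , K′∈ , eq , back with ∈-lookupʳ variants K′∈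
  ...   | K , K∈ , variant = eq , λ σ σ⊨d hs →
    let (σ⊨c , σ⊨c′) , hsL++ , hsR = back σ σ⊨d hs
        hsL , hsK = All.++⁻ L hsL++
    in σ⊨c , hsL , variant-sound (proj₁ (∈-filter⁻ _ K∈)) variant σ σ⊨c′ hsK ∷ hsR

  unfold-sound-all {Us = U ∷ _} (u ∷ us) E∈ with ∈-++⁻ U E∈
  ... | inj₁ E∈U  = _ , here refl , unfold-sound u E∈U
  ... | inj₂ E∈Us = let K , K∈ , s = unfold-sound-all us E∈Us in K , there K∈ , s

-- Derivations of bounded height and completeness of unfolding

module _ (P : List Clause) where

  -- The `n`-th iterate of the immediate consequence operator of `P`, starting from the empty
  -- relation.
  Derivable : ℕ → Relation
  Derivable zero    p as = ⊥
  Derivable (suc n) p as = ∃[ K ] K ∈ P × ∃[ τ ]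
    Instance τ (head K) p as × τ ⊨ᶜ constraint K × All (Holds (Derivable n) τ) (body K)

  derivable-resp : ∀ n → Respects≃ (Derivable n)
  derivable-resp (suc n) p as≃bs (K , K∈P , τ , i , rest) =
    K , K∈P , τ , instance-resp p as≃bs i , rest

  derivable-mono : ∀ {m n} → m ℕ.≤ n → ∀ {p as} → Derivable m p as → Derivable n p as
  derivables-mono : ∀ {m n} → m ℕ.≤ n → ∀ {G σ} →
                    All (Holds (Derivable m) σ) G → All (Holds (Derivable n) σ) G
  derivable-mono (ℕ.s≤s m≤n) (K , K∈P , τ , i , τ⊨c , hs) =
    K , K∈P , τ , i , τ⊨c , derivables-mono m≤n hs
  derivables-mono m≤n []       = []
  derivables-mono m≤n (h ∷ hs) = derivable-mono m≤n h ∷ derivables-mono m≤n hs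

  derivables-bound : ∀ {G σ} → All (Holds (λ p as → ∃[ n ] Derivable n p as) σ) G →
                     ∃[ n ] All (Holds (Derivable n) σ) G
  derivables-bound []             = 0 , []
  derivables-bound ((m , h) ∷ hs) with derivables-bound hs
  ... | n , hs′ = m ℕ.⊔ n , derivable-mono (ℕ.m≤m⊔n m n) h ∷ derivables-mono (ℕ.m≤n⊔m m n) hs′

  derivable⇒holds : ∀ M → All (M ⊨_) P → ∀ n {p as} → Derivable n p as → rel M p as
  derivable⇒holds M M⊨P (suc n) (K , K∈P , τ , i , τ⊨c , hs) =
    instance-headHolds (rel-resp M)
      (All.lookup M⊨P K∈P τ τ⊨c (All.map (derivable⇒holds M M⊨P n) hs)) i

  -- Only agreement on the head is kept: the clauses used for unfolding bring variables of their
  -- own, on which the valuation has to change.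
  UnfoldsTo : ℕ → Maybe Atom → Valuation → List Clause → Set
  UnfoldsTo n H σ U = ∃[ E ] ∃[ σ′ ] E ∈ U × head E ≡ H × σ′ ⊨ᶜ constraint E
    × All (Holds (Derivable n) σ′) (body E) × Agree σ′ σ (maybe′ argList [] H)

  -- The last step of a derivation of an atom of `R` names the clause to unfold with, and its
  -- premises have height `n`. They join `L`, which is why `L` is measured by `n` and `R` by
  -- `suc n`.
  unfold-complete : ∀ n {H c L R U σ} → Unfold P H c L R U → σ ⊨ᶜ c →
    All (Holds (Derivable n) σ) L → All (Holds (Derivable (suc n)) σ) R → UnfoldsTo n H σ U
  unfold-complete-any : ∀ n {H c L R Ks Us K σ} →
    Pointwise (λ K U → Unfold P H (c ∧ constraint K) (L ++ body K) R U) Ks Us → K ∈ Ks →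
    σ ⊨ᶜ c ∧ constraint K → All (Holds (Derivable n) σ) (L ++ body K) →
    All (Holds (Derivable (suc n)) σ) R → UnfoldsTo n H σ (concat Us)

  unfold-complete n {σ = σ} done σ⊨c hsL [] =
    _ , σ , here refl , refl , σ⊨c , hsL , λ {x} _ → ≃-refl {σ x}
  unfold-complete n {H} {c} {L} {A ∷ R} {σ = σ} (unfold variants us) σ⊨c hsL
    ((K , K∈P , τ , i , τ⊨c , hsK) ∷ hsR)
    with ∈-lookupˡ variants (∈-filter⁺ _ K∈P (instance-pred {K = K} i))
  ... | _ , K′∈ , variant with resolve (derivable-resp n) variant i τ⊨c hsK
  ... | σ′ , σ′≈σ , σ′⊨c , hsK′
    -- `σ′` agrees with `σ` on all variables of the current clause, so `c`, `L` and `R` remain true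
    -- under it.
    with unfold-complete-any n {σ = σ′} us K′∈
      (⊨ᶜ-agree c {σ} {σ′} (agree-sym {σ′} {σ} σ′≈σ ∘ varsᶜ⊆vars (H ← c , L ++ A ∷ R)) σ⊨c , σ′⊨c)
      (All.++⁺ (allHold-agree (derivable-resp n) L {σ} {σ′}
        (agree-sym {σ′} {σ} σ′≈σ ∘ varsᵍ⊆vars (H ← c , L ++ A ∷ R) (xs⊆xs++ys L (A ∷ R))) hsL) hsK′)
      (allHold-agree (derivable-resp (suc n)) R {σ} {σ′}
        (agree-sym {σ′} {σ} σ′≈σ ∘
          varsᵍ⊆vars (H ← c , L ++ A ∷ R) (xs⊆ys++xs (A ∷ R) L ∘ there)) hsR)
  ... | E , σ″ , E∈ , eq , σ″⊨ , hs , σ″≈σ′ = E , σ″ , E∈ , eq , σ″⊨ , hs ,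
    λ {x} x∈H → ≃-trans {σ″ x} {σ′ x} {σ x} (σ″≈σ′ x∈H) (σ′≈σ (∈-++⁺ˡ x∈H))

  unfold-complete-any n {Us = U ∷ _} (u ∷ us) (here refl) σ⊨ hsL hsR
    with unfold-complete n u σ⊨ hsL hsR
  ... | E , σ′ , E∈ , rest = E , σ′ , ∈-++⁺ˡ E∈ , rest
  unfold-complete-any n {Us = U ∷ _} (u ∷ us) (there K∈) σ⊨ hsL hsR
    with unfold-complete-any n us K∈ σ⊨ hsL hsR
  ... | E , σ′ , E∈ , rest = E , σ′ , ∈-++⁺ʳ U E∈ , rest

-- The strategy

module _ {ℓ} (𝔻 : AbstractDomain ℓ) (Π : PartitionOperator) (P : List Clause) where

  open AbstractDomain 𝔻
  open PartitionOperator Π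
  open Strategy 𝔻 Π P

  -- `α` only weakens `d`, and `σ` is its own witness for the variables that the projection
  -- quantifies.
  ⊑-projected : ∀ C d G → d ⊑ value (projected C d G)
  ⊑-projected C d G σ σ⊨d =
    Equivalence.from (⇓-∃ (α d) (varsᵍ G) σ) (σ , (λ _ _ → refl) , α-upper d σ σ⊨d)

  -- The common outcome of `reuse`, `widen` and `plain`. Neither direction of the proof looks at how
  -- the definition was obtained.
  FoldsTo : List Clause → Constraint → List⁺ Atom → Atom → Set
  FoldsTo Ds d G A = ∃[ K ] ∃[ e ] K ∈ Ds × HasForm K A e (List⁺.toList G) × d ⊑ e

  BodyFoldsTo : List Clause → Clause → List Atom → Set
  BodyFoldsTo Ds E As = Pointwise (FoldsTo Ds (constraint E)) (partition E) As

  Folded : State → Clause → Set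
  Folded s E = ∃[ As ] BodyFoldsTo (defs s) E As × (head E ← constraint E , As) ∈ transfCls s

  -- The restriction to satisfiable constraints accounts for clause deletion: a deleted clause has
  -- no folded counterpart.
  Processed : State → Clause → Set
  Processed s K =
    ∃[ U ] UnfoldBody P K U × (∀ {E} → E ∈ U → Satisfiableᶜ (constraint E) → Folded s E)

  Derived : State → Clause → Set
  Derived s K = ∃[ D ] ∃[ U ] ∃[ E ] ∃[ As ] D ∈ defs s × UnfoldBody P D U × E ∈ U
    × BodyFoldsTo (defs s) E As × K ≡ (head E ← constraint E , As)

  -- Growth within one iteration. The current clause leaves `inCls` only at the end, which
  -- `iteration-preserves` treats separately.
  record _≼_ (s s′ : State) : Set where
    field
      defs-⊆      : defs s ⊆ defs s′
      inCls-⊆     : inCls s ⊆ inCls s′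
      transfCls-⊆ : transfCls s ⊆ transfCls s′

  open _≼_

  ≼-refl : ∀ {s} → s ≼ s
  ≼-refl = record { defs-⊆ = id ; inCls-⊆ = id ; transfCls-⊆ = id }

  ≼-trans : ∀ {s s′ s″} → s ≼ s′ → s′ ≼ s″ → s ≼ s″
  ≼-trans p q = record
    { defs-⊆      = defs-⊆ q ∘ defs-⊆ p
    ; inCls-⊆     = inCls-⊆ q ∘ inCls-⊆ p
    ; transfCls-⊆ = transfCls-⊆ q ∘ transfCls-⊆ p
    }

  foldsTo-mono : ∀ {Ds Ds′ d G A} → Ds ⊆ Ds′ → FoldsTo Ds d G A → FoldsTo Ds′ d G A
  foldsTo-mono ⊆′ (K , e , K∈ , rest) = K , e , ⊆′ K∈ , rest

  bodyFoldsTo-mono : ∀ {Ds Ds′ E As} → Ds ⊆ Ds′ → BodyFoldsTo Ds E As → BodyFoldsTo Ds′ E As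
  bodyFoldsTo-mono ⊆′ = Pointwise.map (λ {G} {A} → foldsTo-mono {G = G} {A} ⊆′)

  folded-mono : ∀ {s s′ E} → s ≼ s′ → Folded s E → Folded s′ E
  folded-mono {E = E} s≼s′ (As , folds , ∈T) =
    As , bodyFoldsTo-mono {E = E} (defs-⊆ s≼s′) folds , transfCls-⊆ s≼s′ ∈T

  processed-mono : ∀ {s s′ K} → s ≼ s′ → Processed s K → Processed s′ K
  processed-mono s≼s′ (U , unf , f) = U , unf , λ E∈ sat → folded-mono s≼s′ (f E∈ sat)

  derived-mono : ∀ {s s′ K} → s ≼ s′ → Derived s K → Derived s′ K
  derived-mono s≼s′ (D , U , E , As , D∈ , unf , E∈ , folds , eq) =
    D , U , E , As , defs-⊆ s≼s′ D∈ , unf , E∈ , bodyFoldsTo-mono {E = E} (defs-⊆ s≼s′) folds , eq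

  -- `derived`, `distinct` and `goal≡root` serve the passage from a model of `C ∷ P`. `pending`,
  -- `P⊆transf` and `root∈defs` serve the converse, where an empty `inCls` leaves every definition
  -- processed. `new-heads` serves both.
  record Invariant (C : Clause) (s : State) : Set where
    field
      root∈defs  : C ∈ defs s
      inCls⊆defs : inCls s ⊆ defs s
      P⊆transf   : P ⊆ transfCls s
      new-heads  : ∀ {K} → K ∈ defs s → HeadNotIn K P
      goal≡root  : ∀ {K} → K ∈ defs s → head K ≡ nothing → K ≡ C
      distinct   : ∀ {K K′} → K ∈ defs s → K′ ∈ defs s → headPred K ≡ headPred K′ → K ≡ K′
      pending    : ∀ {K} → K ∈ defs s → K ∈ inCls s ⊎ Processed s K
      derived    : ∀ {K} → K ∈ transfCls s → K ∈ P ⊎ Derived s K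

  open Invariant

  initial-invariant : ∀ C → HeadNotIn C P → Invariant C (initial P C)
  initial-invariant C C∉P = record
    { root∈defs  = here refl
    ; inCls⊆defs = id
    ; P⊆transf   = id
    ; new-heads  = λ { (here refl) → C∉P }
    ; goal≡root  = λ { (here refl) _ → refl }
    ; distinct   = λ { (here refl) (here refl) _ → refl }
    ; pending    = inj₁
    ; derived    = inj₁
    }

  headPred∈preds : ∀ {p} K → headPred K ≡ just p → p ∈ preds K
  headPred∈preds (just A ← _ , _) refl = here refl

  hasForm-definition : ∀ A c G → Enumerates A G → HasForm (just A ← c , G) A c G
  hasForm-definition A c G enum = record
    { var-renaming = ↔-id Var
    ; head-≡       = cong just (renameᵃ-id A)
    ; constraint-≡ = renameᶜ-id c
    ; body-↭       = ↭-reflexive (map-id-local (All.tabulate (λ {B} _ → renameᵃ-id B)))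
    ; enumerates   = enum
    }

  addDefinition-preserves : ∀ {C D A c d s} G → Invariant C s → Fresh (pred A) s →
    Enumerates A (List⁺.toList G) → d ⊑ c →
    let s′ = addDefinition D (just A ← c , List⁺.toList G) s in
    Invariant C s′ × s ≼ s′ × FoldsTo (defs s′) d G A
  addDefinition-preserves {C} {D} {A} {c} {d} {s} G inv fresh enum d⊑c =
    record
      { root∈defs  = there (root∈defs inv)
      ; inCls⊆defs = λ { (here refl) → here refl ; (there K∈) → there (inCls⊆defs inv K∈) }
      ; P⊆transf   = P⊆transf inv
      ; new-heads  = λ
          { (here refl) refl A∈P → fresh (concatMap⁺ preds (xs⊆xs++ys P _) A∈P)
          ; (there K∈) → new-heads inv K∈ }
      ; goal≡root  = λ { (here refl) () ; (there K∈) → goal≡root inv K∈ }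
      ; distinct   = λ
          { (here refl) (here refl) _ → refl
          -- Freshness of the new predicate excludes an older definition with the same head.
          ; (here refl) (there K∈) eq → ⊥-elim (unused K∈ (sym eq))
          ; (there K∈) (here refl) eq → ⊥-elim (unused K∈ eq)
          ; (there K∈) (there K′∈) eq → distinct inv K∈ K′∈ eq }
      ; pending    = λ
          { (here refl) → inj₁ (here refl)
          ; (there K∈) → [ inj₁ ∘ there , inj₂ ∘ processed-mono s≼s′ ]′ (pending inv K∈) }
      ; derived    = [ inj₁ , inj₂ ∘ derived-mono s≼s′ ]′ ∘ derived inv
      }
    , s≼s′
    , _ , c , here refl , hasForm-definition A c (List⁺.toList G) enum , d⊑c
    where
    s≼s′ : s ≼ addDefinition D (just A ← c , List⁺.toList G) s
    s≼s′ = record { defs-⊆ = there ; inCls-⊆ = there ; transfCls-⊆ = id }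
    unused : ∀ {K} → K ∈ defs s → headPred K ≢ just (pred A)
    unused {K} K∈ eq = fresh (∈-concatMap⁺ preds
      (Any.map (λ { refl → headPred∈preds K eq }) (∈-++⁺ʳ P (∈-++⁺ˡ K∈))))

  foldPart-preserves : ∀ {C D d s A s′} G → Invariant C s → FoldPart D d (List⁺.toList G) s A s′ →
    Invariant C s′ × s ≼ s′ × FoldsTo (defs s′) d G A
  foldPart-preserves {D = D} {d} G inv (reuse (K , e , K∈ , form , projected⊑e)) =
    inv , ≼-refl , K , e , K∈ , form , λ σ → projected⊑e σ ∘ ⊑-projected D d (List⁺.toList G) σ
  foldPart-preserves {D = D} {d} G inv (widen {f = f} _ _ fresh enum) =
    -- With `dᵢ` the projected constraint: `d ⊑ dᵢ ⊑ f ⊔ dᵢ ⊑ f ∇ (f ⊔ dᵢ)`.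
    addDefinition-preserves G inv fresh enum λ σ →
      ∇-upperʳ f (f ⊔ projected D d Gs) σ ∘ ⊔-upperʳ f (projected D d Gs) σ ∘ ⊑-projected D d Gs σ
    where
    Gs : List Atom
    Gs = List⁺.toList G
  foldPart-preserves {D = D} {d} G inv (plain _ _ fresh enum) =
    addDefinition-preserves G inv fresh enum (⊑-projected D d (List⁺.toList G))

  foldParts-preserves : ∀ {C D d Gs s As s′} → Invariant C s → FoldParts D d Gs s As s′ →
    Invariant C s′ × s ≼ s′ × Pointwise (FoldsTo (defs s′) d) Gs As
  foldParts-preserves inv [] = inv , ≼-refl , []
  foldParts-preserves inv (_∷_ {G = G} {A = A} part parts)
    with foldPart-preserves G inv part
  ... | inv′ , s≼s′ , folds with foldParts-preserves inv′ parts
  ...   | inv″ , s′≼s″ , foldss =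
    inv″ , ≼-trans s≼s′ s′≼s″ , foldsTo-mono {G = G} {A} (defs-⊆ s′≼s″) folds ∷ foldss

  addTransformed : Clause → State → State
  addTransformed K s = record s { transfCls = K ∷ transfCls s }

  addTransformed-≼ : ∀ {K s} → s ≼ addTransformed K s
  addTransformed-≼ = record { defs-⊆ = id ; inCls-⊆ = id ; transfCls-⊆ = there }

  addTransformed-preserves : ∀ {C K s} → Invariant C s → Derived s K →
                             Invariant C (addTransformed K s)
  addTransformed-preserves {C} {K} {s} inv der = record
    { root∈defs  = root∈defs inv
    ; inCls⊆defs = inCls⊆defs inv
    ; P⊆transf   = there ∘ P⊆transf inv
    ; new-heads  = new-heads inv
    ; goal≡root  = goal≡root inv
    ; distinct   = distinct inv
    ; pending    = λ K∈ → [ inj₁ , inj₂ ∘ processed-mono s≼s′ ]′ (pending inv K∈)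
    ; derived    = λ
        { (here refl) → inj₂ (derived-mono s≼s′ der)
        ; (there K∈) → [ inj₁ , inj₂ ∘ derived-mono s≼s′ ]′ (derived inv K∈) }
    }
    where
    s≼s′ : s ≼ addTransformed K s
    s≼s′ = addTransformed-≼

  -- `V` stays the whole result of unfolding `D` while `U` shrinks as its clauses are folded.
  -- `Derived` refers to `V`, so `U ⊆ V` is carried through the induction.
  foldClauses-preserves : ∀ {C D U V s s′} → Invariant C s → D ∈ defs s → UnfoldBody P D V → U ⊆ V →
    FoldClauses D U s s′ → Invariant C s′ × s ≼ s′ × (∀ {E} → E ∈ U → Folded s′ E)
  foldClauses-preserves inv D∈ unf U⊆V [] = inv , ≼-refl , λ ()
  foldClauses-preserves {U = U} inv D∈ unf U⊆V (fold {E = E} {As = As} E∈U parts rest)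
    with foldParts-preserves inv parts
  ... | inv′ , s≼s′ , folds
    with foldClauses-preserves
      (addTransformed-preserves inv′
        (_ , _ , E , As , defs-⊆ s≼s′ D∈ , unf , U⊆V E∈U , folds , refl))
      (defs-⊆ s≼s′ D∈) unf (U⊆V ∘ All.lookup (All.─⁺ E∈U (All.tabulate id))) rest
  ...   | inv″ , s′≼s″ , folded =
    inv″ , ≼-trans s≼s′ (≼-trans addTransformed-≼ s′≼s″) , λ E′∈U →
      [ (λ { refl → folded-mono s′≼s″ (As , folds , here refl) }) , folded ]′ (∈-─ E′∈U E∈U)

  iteration-preserves : ∀ {C s s′} → Invariant C s → Iteration s s′ → Invariant C s′
  iteration-preserves {C} inv
    (iteration {C = D} {U} {U′} {s′} D∈ unf (deleted , inter , unsat , _) folds D∈s′)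
    with foldClauses-preserves inv (inCls⊆defs inv D∈) unf
      (∈-resp-↭ (↭-sym (toPermutation inter)) ∘ ∈-++⁺ˡ) folds
  ... | inv′ , s≼s′ , folded = record
    { root∈defs  = root∈defs inv′
    ; inCls⊆defs = inCls⊆defs inv′ ∘ All.lookup (All.─⁺ D∈s′ (All.tabulate id))
    ; P⊆transf   = P⊆transf inv′
    ; new-heads  = new-heads inv′
    ; goal≡root  = goal≡root inv′
    ; distinct   = distinct inv′
    -- Dropping `D` from `inCls` changes neither `defs` nor `transfCls`, so `Processed` carries over
    -- as it is.
    ; pending    = λ K∈ → [ remaining , inj₂ ]′ (pending inv′ K∈)
    ; derived    = derived inv′
    }
    where
    processed : Processed s′ D
    -- A clause of `U` with a satisfiable constraint is not among the deleted ones, hence it has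
    -- been folded.
    processed = U , unf , λ E∈U sat →
      [ folded , (λ E∈del → contradiction sat (All.lookup unsat E∈del)) ]′
      (∈-++⁻ U′ (∈-resp-↭ (toPermutation inter) E∈U))
    remaining : ∀ {K} → K ∈ inCls s′ → K ∈ (inCls s′ ─ D∈s′) ⊎ Processed s′ K
    remaining K∈ = [ (λ { refl → inj₂ processed }) , inj₁ ]′ (∈-─ K∈ D∈s′)

  star-preserves : ∀ {C s s′} → Invariant C s → Star Iteration s s′ → Invariant C s′
  star-preserves inv Star.ε        = inv
  star-preserves inv (i Star.◅ is) = star-preserves (iteration-preserves inv i) is

  -- Satisfiability is preserved

  renamed-headPred : ∀ {ρ} H {A} → Maybe.map (renameᵃ ρ) H ≡ just A →
                     Maybe.map pred H ≡ just (pred A)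
  renamed-headPred (just _) refl = refl

  pred∈preds : ∀ {K A} → K ∈ P → A ∈ body K → pred A ∈ concatMap preds P
  pred∈preds {K} K∈P A∈ = ∈-concatMap⁺ preds
    (Any.map (λ { refl → ∈-++⁺ʳ (maybe′ (λ A → [ pred A ]) [] (head K)) (∈-map⁺ pred A∈) }) K∈P)

  headPred∈P : ∀ {K p} → K ∈ P → headPred K ≡ just p → p ∈ concatMap preds P
  headPred∈P {K} K∈P eq = ∈-concatMap⁺ preds (Any.map (λ { refl → headPred∈preds K eq }) K∈P)

  module _ {C s} (inv : Invariant C s) where

    -- From a model of `C` and `P` to a model of `transfCls s`

    module Forward (M : Interpretation) (M⊨C : M ⊨ C) (M⊨P : All (M ⊨_) P) where

      -- The constraint of K can be left out, since a folded clause keeps its own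
      -- constraint d.
      defined : Relation
      defined p as = (p ∈ concatMap preds P × rel M p as)
        ⊎ ∃[ K ] K ∈ defs s × ∃[ τ ] Instance τ (head K) p as × All (Holds (rel M) τ) (body K)

      definedModel : Interpretation
      definedModel = record
        { rel      = defined
        ; rel-resp = λ
            { p as≃bs (inj₁ (p∈P , h)) → inj₁ (p∈P , rel-resp M p as≃bs h)
            ; p as≃bs (inj₂ (K , K∈ , τ , i , hs)) →
                inj₂ (K , K∈ , τ , instance-resp p as≃bs i , hs) }
        }

      not-in-P : ∀ {K p} → K ∈ defs s → headPred K ≡ just p → p ∉ concatMap preds P
      not-in-P {just A ← _ , _} K∈ refl = new-heads inv K∈ refl

      -- Heads of definitions do not occur in `P`, which rules out the second alternative of
      -- `defined`.
      old-defined : ∀ {p as} → p ∈ concatMap preds P → defined p as → rel M p as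
      old-defined p∈P (inj₁ (_ , h)) = h
      old-defined p∈P (inj₂ (K , K∈ , _ , i , _)) =
        contradiction p∈P (not-in-P K∈ (instance-pred {K = K} i))

      defined-body : ∀ {K σ} → K ∈ P → All (Holds defined σ) (body K) →
                     All (Holds (rel M) σ) (body K)
      defined-body K∈P hs = All.tabulate λ A∈ → old-defined (pred∈preds K∈P A∈) (All.lookup hs A∈)

      old-head : ∀ {K σ} → K ∈ P → HeadHolds (rel M) σ (head K) → HeadHolds defined σ (head K)
      old-head {just _ ← _ , _} K∈P h = inj₁ (headPred∈P K∈P refl , h)

      defined-⊨P : ∀ {K} → K ∈ P → definedModel ⊨ K
      defined-⊨P K∈P σ σ⊨c hs =
        old-head {σ = σ} K∈P (All.lookup M⊨P K∈P σ σ⊨c (defined-body K∈P hs))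

      defined-⊨defs : ∀ {K} → K ∈ defs s → ∀ σ → σ ⊨ᶜ constraint K →
                      All (Holds (rel M) σ) (body K) → HeadHolds defined σ (head K)
      defined-⊨defs {K@(just _ ← _ , _)} K∈ σ σ⊨c hs =
        inj₂ (K , K∈ , σ , inst (Vecʳ.refl (λ {x} → ≃-refl {x})) , hs)
      -- A definition with head `false` can only be the root `C`, which `M` satisfies.
      defined-⊨defs {K@(nothing ← _ , _)} K∈ σ σ⊨c hs = M⊨goal σ σ⊨c hs
        where
        M⊨goal : M ⊨ K
        M⊨goal = subst (M ⊨_) (sym (goal≡root inv K∈ refl)) M⊨C

      -- The witness for `A` comes from a definition `K′` of the same predicate, and `distinct`
      -- identifies it with `K`. All variables of `G` are arguments of `A`, so the witnessing
      -- valuation, once renamed, agrees with `σ` on `G`.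
      fold-sound : ∀ {d σ} G {A} → FoldsTo (defs s) d G A → Holds defined σ A →
                   All (Holds (rel M) σ) (List⁺.toList G)
      fold-sound G {A} (K , e , K∈ , form , _) h
        with renamed-headPred (head K) (HasForm.head-≡ form)
      fold-sound G (K , e , K∈ , form , _) (inj₁ (A∈P , _)) | headPred≡ =
        contradiction A∈P (not-in-P K∈ headPred≡)
      fold-sound {σ = σ} G {A} (K , e , K∈ , form , _) (inj₂ (K′ , K′∈ , τ , i , hs)) | headPred≡
        with distinct inv K′∈ K∈ (trans (instance-pred {K = K′} i) (sym headPred≡))
      ... | refl = allHold-agree (rel-resp M) (List⁺.toList G) {τ ∘ from ρ} {σ}
        (instance-agree ρ i head-≡ ∘ proj₂ (proj₂ enumerates))
        (All-resp-↭ body-↭ (allHold-unrename (rel M) ρ hs))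
        where
        open HasForm form renaming (var-renaming to ρ)

      folds-sound : ∀ {d σ Gs As} → Pointwise (FoldsTo (defs s) d) Gs As →
                    All (Holds defined σ) As → All (Holds (rel M) σ) (concatMap List⁺.toList Gs)
      folds-sound [] [] = []
      folds-sound (_∷_ {x = G} {y = A} f fs) (h ∷ hs) =
        All.++⁺ (fold-sound G f h) (folds-sound fs hs)

      defined-⊨ : ∀ {K} → K ∈ transfCls s → definedModel ⊨ K
      defined-⊨ K∈T with derived inv K∈T
      ... | inj₁ K∈P = defined-⊨P K∈P
      ... | inj₂ (D , U , E , As , D∈ , unf , E∈U , folds , refl) with unfold-sound P M M⊨P unf E∈U
      ...   | head≡ , back = λ σ σ⊨d hs →
        let σ⊨c , _ , hsD = back σ σ⊨d (All-resp-↭ (partition-↭ E) (folds-sound folds hs))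
        in subst (HeadHolds defined σ) (sym head≡) (defined-⊨defs D∈ σ σ⊨c hsD)

      transformed-satisfiable : Satisfiable (transfCls s)
      transformed-satisfiable = definedModel , All.tabulate defined-⊨

    -- From a model of `transfCls s` to a model of `C` and `P`

    module Backward (finished : inCls s ≡ []) (M : Interpretation)
                    (M⊨T : All (M ⊨_) (transfCls s)) where

      M⊨P : All (M ⊨_) P
      M⊨P = All.tabulate (All.lookup M⊨T ∘ P⊆transf inv)

      defs-processed : ∀ {K} → K ∈ defs s → Processed s K
      defs-processed K∈ with pending inv K∈
      ... | inj₂ processed = processed
      ... | inj₁ K∈inCls with subst (_ ∈_) finished K∈inCls
      ...   | ()

      -- Mutual induction on the height: `definitions-hold n` relies on `fold-complete n`, which for
      -- `n = suc m` relies on `definitions-hold m`.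
      definitions-hold : ∀ n {K} → K ∈ defs s → ∀ σ → σ ⊨ᶜ constraint K →
        All (Holds (Derivable P (suc n)) σ) (body K) → HeadHolds (rel M) σ (head K)

      fold-complete : ∀ n {d σ} G {A} → FoldsTo (defs s) d G A → σ ⊨ᶜ d →
        All (Holds (Derivable P n) σ) (List⁺.toList G) → Holds (rel M) σ A
      fold-complete (suc n) {d} {σ} G (K , e , K∈ , form , d⊑e) σ⊨d hs =
        subst (HeadHolds (rel M) σ) head-≡
          (subst id (sym (headHolds-rename (rel M) (to ρ) (head K)))
          (definitions-hold n K∈ (σ ∘ to ρ)
            (⊨ᶜ-rename⁻ (to ρ) (constraint K) {σ} {σ ∘ to ρ} (λ x → ≃-refl {σ (to ρ x)})
              (subst (σ ⊨ᶜ_) (sym constraint-≡) (d⊑e σ σ⊨d)))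
            (allHold-rename⁻ (Derivable P (suc n)) (to ρ) (All-resp-↭ (↭-sym body-↭) hs))))
        where
        open HasForm form renaming (var-renaming to ρ)
      -- Subconjunctions are nonempty and no atom is derivable at height 0, so the base case is
      -- vacuous.
      fold-complete zero (B ∷ _) _ _ (() ∷ _)

      folds-complete : ∀ n {d σ Gs As} → Pointwise (FoldsTo (defs s) d) Gs As → σ ⊨ᶜ d →
        All (Holds (Derivable P n) σ) (concatMap List⁺.toList Gs) → All (Holds (rel M) σ) As
      folds-complete n [] σ⊨d [] = []
      folds-complete n {σ = σ} (_∷_ {x = G} {y = A} f fs) σ⊨d hs with All.++⁻ (List⁺.toList G) hs
      ... | hsG , hsGs = fold-complete n {σ = σ} G {A} f σ⊨d hsG ∷ folds-complete n fs σ⊨d hsGs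

      definitions-hold n {K} K∈ σ σ⊨c hs with defs-processed K∈
      ... | U , unf , folded with unfold-complete P n unf σ⊨c [] hs
      -- `σ′` itself shows that the constraint of `E` is satisfiable, so `E` survived deletion and
      -- has a folded form in `transfCls s`.
      ...   | E , σ′ , E∈U , head≡ , σ′⊨d , hsE , σ′≈σ with folded E∈U (σ′ , σ′⊨d)
      ...     | As , folds , ∈T = headHolds-agree (rel-resp M) (head K) {σ′} {σ} σ′≈σ
        (subst (HeadHolds (rel M) σ′) head≡ (All.lookup M⊨T ∈T σ′ σ′⊨d
          (folds-complete n folds σ′⊨d (All-resp-↭ (↭-sym (partition-↭ E)) hsE))))

      leastModel : Interpretation
      leastModel = record
        { rel      = λ p as → ∃[ n ] Derivable P n p as
        ; rel-resp = λ { p as≃bs (n , h) → n , derivable-resp P n p as≃bs h }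
        }

      least-⊨P : ∀ {K} → K ∈ P → leastModel ⊨ K
      least-⊨P {K} K∈P σ σ⊨c hs with derivables-bound P hs
      least-⊨P {just A ← c , G} K∈P σ σ⊨c hs | n , hs′ =
        suc n , _ , K∈P , σ , inst (Vecʳ.refl (λ {x} → ≃-refl {x})) , σ⊨c , hs′
      -- Derivable atoms hold in `M`, so a violated goal of `P` would be violated in `M` too.
      least-⊨P {nothing ← c , G} K∈P σ σ⊨c hs | n , hs′ =
        All.lookup M⊨P K∈P σ σ⊨c (All.map (derivable⇒holds P M M⊨P n) hs′)

      -- It coincides with `M` on the predicates of `P` and is vacuously true on all others, among
      -- them the head predicate of `C` when there is one.
      trivialModel : Interpretation
      trivialModel = record
        { rel      = λ p as → p ∈ concatMap preds P → rel M p as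
        ; rel-resp = λ p as≃bs h p∈P → rel-resp M p as≃bs (h p∈P)
        }

      trivial-⊨P : ∀ {K} → K ∈ P → trivialModel ⊨ K
      trivial-⊨P {K} K∈P σ σ⊨c hs = lift (head K) (All.lookup M⊨P K∈P σ σ⊨c
        (All.tabulate λ A∈ → All.lookup hs A∈ (pred∈preds K∈P A∈)))
        where
        lift : ∀ H → HeadHolds (rel M) σ H → HeadHolds (rel trivialModel) σ H
        lift (just _) h _ = h

      original-satisfiable : Satisfiable (C ∷ P)
      original-satisfiable with head C in head≡
      ... | just A  = trivialModel , trivial-⊨C ∷ All.tabulate trivial-⊨P
        where
        trivial-⊨C : trivialModel ⊨ C
        trivial-⊨C σ _ _ = subst (HeadHolds (rel trivialModel) σ) (sym head≡)
          λ A∈P → contradiction A∈P (new-heads inv (root∈defs inv) head≡)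
      ... | nothing = leastModel , least-⊨C ∷ All.tabulate least-⊨P
        where
        least-⊨C : leastModel ⊨ C
        least-⊨C σ σ⊨c hs with derivables-bound P hs
        -- The bound `n` may be 0 while `definitions-hold` expects a successor. Heights are upper
        -- bounds, so it is raised by one.
        ... | n , hs′ = ⊥-elim (subst (HeadHolds (rel M) σ) head≡
          (definitions-hold n (root∈defs inv) σ σ⊨c (derivables-mono P (ℕ.n≤1+n n) hs′)))

theorem1 : ∀ {ℓ} (𝔻 : AbstractDomain ℓ) (Π : PartitionOperator)
    (P : List Clause) (C : Clause) →
    All WellFormed (C ∷ P) → HeadNotIn C P →
    (TransfCls : List Clause) → Strategy.Returns 𝔻 Π P C TransfCls →
    Satisfiable (C ∷ P) ⇔ Satisfiable TransfCls
theorem1 𝔻 Π P C _ C∉P _ (s , run , finished , refl) = mk⇔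
  (λ { (M , M⊨C ∷ M⊨P) → Forward.transformed-satisfiable 𝔻 Π P inv M M⊨C M⊨P })
  (λ (M , M⊨T) → Backward.original-satisfiable 𝔻 Π P inv finished M M⊨T)
  where
  inv : Invariant 𝔻 Π P C s
  inv = star-preserves 𝔻 Π P (initial-invariant 𝔻 Π P C C∉P) run
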